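{- There is an algorithm (Split-and-Refine) with the following properties. It may use as a black box any given algorithm $\mathcal{A}$ that, on input a fixed-topology rooted tree with $N$ nodes and a known block size $B$, outputs a layout with block size $B$ whose maximum block cost is within a constant multiplicative factor of the minimum possible maximum block cost over all layouts with block size $B$. Using $\mathcal{A}$, it takes as input any rooted tree with $N$ nodes (but no block size), and outputs a cache-oblivious layout whose maximum block cost is, for every block size $B \ge 1$, at most a constant factor times the minimum possible maximum block cost over all layouts with block size $B$; this constant depends only on the approximation factor of $\mathcal{A}$ (in particular not on the tree, $N$, $B$, or the alignment of blocks). If $\mathcal{A}$ runs in time $T(N,B)=\Omega(N)$, then the running time of Split-and-Refine is $$O\Big(\sum_{l=0}^{\lceil \lg N\rceil} T(N,2^l)\Big).$$
   Context: The tree is a finite rooted tree with fixed parent/child structure and $N$ nodes (arbitrary degrees). $\lg$ is the base-2 logarithm. A layout with (known) block size $B$ is a partition of the nodes into blocks, each containing at most $B$ nodes. The maximum block cost of a layout is the maximum, over all root-to-leaf paths, of the number of (distinct) blocks containing nodes of the path. A cache-oblivious layout is a linear order of all the nodes of the tree in memory, chosen without knowledge of the block size. For a block size $B$, memory is divided into consecutive blocks of $B$ slots (with arbitrary alignment relative to the start of the order), so the order is cut into consecutive blocks of at most $B$ nodes; the maximum block cost of the cache-oblivious layout for block size $B$ is the maximum over root-to-leaf paths of the number of such blocks containing nodes of the path. The guarantee is for all values of $B$ and all alignments. -}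

module Defs where

open import Data.Bool using (if_then_else_)
open import Data.Fin using (Fin; toℕ; fromℕ<)
open import Data.Fin.Permutation using (Permutation′; _⟨$⟩ʳ_; _⟨$⟩ˡ_)
import Data.Fin.Properties as Fin
open import Data.List using (List; length; map; filter; deduplicate; allFin; iterate; upTo)
open import Data.List.Extrema.Nat using (max)
open import Data.Nat using (ℕ; suc; _+_; _*_; _∸_; _^_; _/_; _≤_; _≟_; _<?_; NonZero)
open import Data.Nat.GeneralisedArithmetic using (fold)
open import Data.Nat.ListAction using (sum)
open import Data.Nat.Logarithm using (⌈log₂_⌉)
open import Data.Product using (Σ-syntax; ∃-syntax; _×_)
open import Data.Vec using (Vec; lookup; count; tabulate)
open import Relation.Binary.PropositionalEquality using (_≡_; _≢_)
open import Relation.Nullary using (Dec; yes; no; does; ¬_; ¬?; _×-dec_)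

-- Rooted trees whose nodes carry arbitrary labels in Fin N; by convention the
-- root is its own parent.  The reachability field excludes cycles.

record Tree (N : ℕ) : Set where
  field
    parents      : Vec (Fin N) N
    root         : Fin N

  parent : Fin N → Fin N
  parent = lookup parents

  field
    root-parent  : parent root ≡ root
    .reachesRoot : ∀ v → ∃[ k ] fold v parent k ≡ root

  Child : Fin N → Fin N → Set
  Child w v = w ≢ root × parent w ≡ v

  Leaf : Fin N → Set
  Leaf v = ¬ (∃[ w ] Child w v)

  leaf? : ∀ v → Dec (Leaf v)
  leaf? v = ¬? (Fin.any? (λ w → ¬? (w Fin.≟ root) ×-dec (parent w Fin.≟ v)))

  -- A node has fewer than N proper ancestors, so N iterates go all the way up
  -- to the root; surplus entries only repeat the root.
  pathToRoot : Fin N → List (Fin N)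
  pathToRoot v = iterate parent v N

open Tree public

-- A partition of the nodes is given by a map sending each node to the name of
-- its block.

distinct : List ℕ → ℕ
distinct xs = length (deduplicate _≟_ xs)

maxBlockCost : ∀ {N} → Tree N → (Fin N → ℕ) → ℕ
maxBlockCost {N} t block =
  max 0 (map (λ v → distinct (map block (pathToRoot t v)))
             (filter (leaf? t) (allFin N)))

-- A partition of N nodes has at most N nonempty blocks, so N names suffice.
record Layout (N B : ℕ) : Set where
  field
    blocks  : Vec (Fin N) N
    bounded : ∀ j → count (Fin._≟ j) blocks ≤ B

open Layout public

layoutCost : ∀ {N B} → Tree N → Layout N B → ℕ
layoutCost t L = maxBlockCost t (λ v → toℕ (lookup (blocks L) v))

IsMinCost : ∀ {N} → Tree N → (B m : ℕ) → Set
IsMinCost {N} t B m =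
    (Σ[ L ∈ Layout N B ] layoutCost t L ≡ m)
  × (∀ (L : Layout N B) → m ≤ layoutCost t L)

-- π ⟨$⟩ʳ i is the node in slot i, so π ⟨$⟩ˡ v is the slot of v; s is the
-- offset of slot 0 within its block.
linearBlock : ∀ {N} → Permutation′ N → (B : ℕ) .{{_ : NonZero B}} → Fin B →
              Fin N → ℕ
linearBlock π B s v = (toℕ (π ⟨$⟩ˡ v) + toℕ s) / B

linearCost : ∀ {N} → Tree N → Permutation′ N →
             (B : ℕ) .{{_ : NonZero B}} → Fin B → ℕ
linearCost t π B s = maxBlockCost t (linearBlock π B s)

record BlackBox : Set where
  field
    layout : ∀ {N} → Tree N → (B : ℕ) .{{_ : NonZero B}} → Layout N B
    time   : ∀ {N} → Tree N → (B : ℕ) .{{_ : NonZero B}} → ℕ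

open BlackBox public

Approximates : ℕ → BlackBox → Set
Approximates c A =
  ∀ {N} (t : Tree N) (B : ℕ) .{{_ : NonZero B}} (m : ℕ) →
  IsMinCost t B m → layoutCost t (layout A t B) ≤ c * m

RunsInTime : BlackBox → (ℕ → ℕ → ℕ) → Set
RunsInTime A T =
  ∀ {N} (t : Tree N) (B : ℕ) .{{_ : NonZero B}} → time A t B ≤ T N B

-- T(N,B) = Ω(N), uniformly in B.
Ω[N] : (ℕ → ℕ → ℕ) → Set
Ω[N] T = ∃[ κ ] ∃[ n₀ ]
  (∀ N B .{{_ : NonZero B}} → n₀ ≤ N → N ≤ κ * T N B)

-- Algorithms are programs of a unit-cost random access machine with addition
-- and truncated subtraction (no multiplication), extended by an instruction
-- that invokes the black box.  Registers and arrays are named by naturals and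
-- arrays are unbounded; a program mentions only finitely many of them.

data Expr : Set where
  lit       : ℕ → Expr
  reg       : ℕ → Expr
  cell      : ℕ → Expr → Expr
  _⊕_ _⊖_   : Expr → Expr → Expr

infixl 6 _⊕_ _⊖_
infix  5 _≔_ _[_]≔_
infixr 4 _⨾_

data Program : Set where
  skip       : Program
  _≔_        : ℕ → Expr → Program
  _[_]≔_     : ℕ → Expr → Expr → Program
  _⨾_        : Program → Program → Program
  cond       : Expr → Program → Program → Program
  while      : Expr → Program → Program
  -- callLayout n p b o : run the black box on the tree with n nodes whose
  -- parent function is in array p, for block size b, with the result placed
  -- in array o.
  callLayout : Expr → ℕ → Expr → ℕ → Program

record State : Set where
  field
    regs : ℕ → ℕ
    mem  : ℕ → ℕ → ℕ

open State public

eval : State → Expr → ℕ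
eval σ (lit n)    = n
eval σ (reg x)    = regs σ x
eval σ (cell a e) = mem σ a (eval σ e)
eval σ (d ⊕ e)    = eval σ d + eval σ e
eval σ (d ⊖ e)    = eval σ d ∸ eval σ e

update : ∀ {A : Set} → (ℕ → A) → ℕ → A → ℕ → A
update f x a y = if does (x ≟ y) then a else f y

setReg : State → ℕ → ℕ → State
setReg σ x n = record σ { regs = update (regs σ) x n }

setArray : State → ℕ → (ℕ → ℕ) → State
setArray σ a f = record σ { mem = update (mem σ) a f }

overwrite : ∀ {k M} → Vec (Fin k) M → (ℕ → ℕ) → ℕ → ℕ
overwrite {M = M} xs f i with i <? M
... | yes i<M = toℕ (lookup xs (fromℕ< i<M))
... | no  _   = f i

Stores : ∀ {k M} → (ℕ → ℕ) → Vec (Fin k) M → Set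
Stores f xs = ∀ i → f (toℕ i) ≡ toℕ (lookup xs i)

-- Exec A p σ σ′ τ : p started in σ halts in σ′ after τ steps.  Expressions
-- occur literally in the program, so charging one step per instruction changes
-- the running time only by a constant factor.  Tests succeed on nonzero values.

data Exec (A : BlackBox) : Program → State → State → ℕ → Set where
  skip : ∀ {σ} → Exec A skip σ σ 1

  assign : ∀ {σ x e} → Exec A (x ≔ e) σ (setReg σ x (eval σ e)) 1

  store : ∀ {σ a d e} →
    Exec A (a [ d ]≔ e) σ
      (setArray σ a (update (mem σ a) (eval σ d) (eval σ e))) 1

  seq : ∀ {p q σ σ₁ σ₂ τ₁ τ₂} →
    Exec A p σ σ₁ τ₁ → Exec A q σ₁ σ₂ τ₂ →
    Exec A (p ⨾ q) σ σ₂ (τ₁ + τ₂)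

  if-true : ∀ {e p q σ σ′ τ} → eval σ e ≢ 0 →
    Exec A p σ σ′ τ → Exec A (cond e p q) σ σ′ (suc τ)

  if-false : ∀ {e p q σ σ′ τ} → eval σ e ≡ 0 →
    Exec A q σ σ′ τ → Exec A (cond e p q) σ σ′ (suc τ)

  while-true : ∀ {e p σ σ₁ σ₂ τ₁ τ₂} → eval σ e ≢ 0 →
    Exec A p σ σ₁ τ₁ → Exec A (while e p) σ₁ σ₂ τ₂ →
    Exec A (while e p) σ σ₂ (suc (τ₁ + τ₂))

  while-false : ∀ {e p σ} → eval σ e ≡ 0 → Exec A (while e p) σ σ 1

  call : ∀ {n p b o σ M B} .{{_ : NonZero B}} (t : Tree M) →
    eval σ n ≡ M → Stores (mem σ p) (parents t) → eval σ b ≡ B →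
    Exec A (callLayout n p b o) σ
      (setArray σ o (overwrite (blocks (layout A t B)) (mem σ o)))
      (suc (time A t B))

-- Input: N in register 0 and the parent function in array 0, all else zero.
initial : ∀ {N} → Tree N → State
initial {N} t = record
  { regs = update (λ _ → 0) 0 N
  ; mem  = update (λ _ _ → 0) 0 (overwrite (parents t) (λ _ → 0))
  }

-- Output: array 1 lists the nodes in memory order.
Outputs : ∀ {N} → BlackBox → Program → Tree N → Permutation′ N → ℕ → Set
Outputs A P t π τ = ∃[ σ ]
  (Exec A P (initial t) σ τ × Stores (mem σ 1) (tabulate (π ⟨$⟩ʳ_)))

-- Σ_{l=0}^{⌈lg N⌉} T(N, 2^l)
timeSum : (ℕ → ℕ → ℕ) → ℕ → ℕ
timeSum T N = sum (map (λ l → T N (2 ^ l)) (upTo (suc ⌈log₂ N ⌉)))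

{-# OPTIONS --safe #-}

-- A greedy bottom-up layout serves for every block size, so the program never
-- invokes the approximation algorithm.  For b = 1, 2, 4, … ≤ N a node joins the
-- blocks of its children of maximal level h, or opens level h + 1 if they have
-- no room for it within b nodes; thus the levels along a path name its blocks.
-- If h is the level of the root, any layout with blocks of fewer than 2b nodes
-- costs at least h/3: going down from a node that opened a level, the at least
-- b nodes of the previous level below it either include a new block, to which
-- the path is directed, or use up b places in the blocks already met.
--
-- Starting from any order, a greedy layout is kept only when its number of
-- levels is at most half that of the layout kept before, and the order is then
-- stably sorted by its blocks.  A later sort never moves two nodes apart that
-- also share a block of the later layout, so at the end the number of short
-- pieces on a path is at most the sum of the numbers of levels of the layouts
-- kept from b on, a geometric series.  For block size B, take for b the largest
-- power of two not exceeding B.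

module Submission where

open import Data.Bool using (if_then_else_)
open import Data.Empty using (⊥)
open import Data.Fin as Fin using (Fin; zero; suc; toℕ; fromℕ<; punchOut)
import Data.Fin.Permutation as Perm
open import Data.Fin.Permutation using (Permutation′; permutation; _⟨$⟩ʳ_; _⟨$⟩ˡ_; inverseˡ; inverseʳ)
import Data.Fin.Properties as Fin
open import Data.List as List using (List; []; _∷_; _++_; length; filter; allFin)
open import Data.List.Extrema.Nat using (v≤max⁺; max≤v⁺)
open import Data.List.Membership.Propositional using (_∈_; _∉_)
open import Data.List.Membership.Propositional.Properties
  using (∈-∃++; ∈-deduplicate⁺; ∈-deduplicate⁻; ∈-++⁺ˡ; ∈-++⁺ʳ; ∈-++⁻; ∈-map⁺; ∈-map⁻; ∈-filter⁺; ∈-allFin)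
open import Data.List.Properties using (length-++; length-upTo; ∷-injectiveˡ; ∷-injectiveʳ)
open import Data.List.Relation.Unary.All as All using (All; []; _∷_)
open import Data.List.Relation.Unary.Any as Any using (here; there)
open import Data.List.Relation.Unary.Unique.DecPropositional.Properties using (deduplicate-!)
open import Data.List.Relation.Unary.Unique.Propositional using (Unique; []; _∷_)
open import Data.Nat
open import Data.Nat.DivMod using (/-monoˡ-≤; m/n≡1+[m∸n]/n)
open import Data.Nat.GeneralisedArithmetic using (fold)
open import Data.Nat.Induction using (<-wellFounded)
open import Data.Nat.ListAction using (sum)
open import Data.Nat.Logarithm using (⌈log₂_⌉)
open import Data.Nat.Logarithm.Core using (⌈log2⌉)
open import Data.Nat.Properties
open import Data.Product using (Σ-syntax; ∃; ∃-syntax; _×_; _,_; proj₁; proj₂)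
open import Data.Sum using (_⊎_; inj₁; inj₂; [_,_]′)
open import Data.Unit using (tt)
open import Data.Vec using (Vec; []; _∷_; lookup; count)
open import Data.Vec.Properties using (lookup∘tabulate)
open import Defs
open import Function using (_∘_; id)
open import Induction.WellFounded using (Acc; acc)
open import Level using (0ℓ)
open import Relation.Binary.Definitions using (tri<; tri≈; tri>)
open import Relation.Binary.PropositionalEquality
open import Relation.Nullary
open import Relation.Nullary.Decidable using (recompute; map′; dec-true; dec-false)
open import Relation.Unary using (Pred; Decidable)
open import Data.List.Membership.DecPropositional _≟_ using (_∈?_)


-- Counting in finite sets

-- The halving rule balances two demands through the threshold `q`. A layout with `g` levels is kept
-- only if `g + g ≤ q`; it adds fewer than `g` pieces to a path and leaves `g` as the next
-- threshold, so `q` pays in advance for everything still to come. If it is dropped, then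
-- `q < g + g`, and the lower bound for `g` at size `b` shows that the layout kept last is within a
-- constant of the optimum there too. The constant is 48 = 6 * 8. A piece meets memory blocks with
-- at most three names and the geometric series costs a factor 2, which gives 6; the levels are at
-- most 4 times the cost of any layout and dropping a layout loses a factor 2, which gives 8. For
-- the time, the sum over `T` has as many terms as there are rounds, each of order `N` or more, so
-- every round must be linear. Hence counting sort. Node labels say nothing about ancestry, so an
-- order by depth is computed beforehand; walking up from each node could take quadratic time,
-- whereas pointer jumping needs a logarithmic number of linear rounds.

private variable
  n : ℕ


# : {P : Pred (Fin n) 0ℓ} → Decidable P → ℕ
# {zero}  P? = 0
# {suc n} P? = (if does (P? zero) then 1 else 0) + # (P? ∘ suc)

#-cover : {P Q R : Pred (Fin n) 0ℓ} (P? : Decidable P) (Q? : Decidable Q) (R? : Decidable R) →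
          (∀ i → R i → P i ⊎ Q i) → # R? ≤ # P? + # Q?
#-cover {zero}  P? Q? R? f = z≤n
#-cover {suc n} P? Q? R? f
  with ih ← #-cover (P? ∘ suc) (Q? ∘ suc) (R? ∘ suc) (f ∘ suc)
  with P? zero | Q? zero | R? zero
... | yes _ | yes _ | yes _ = s≤s (≤-trans ih (+-monoʳ-≤ _ (n≤1+n _)))
... | yes _ | yes _ | no  _ = m≤n⇒m≤1+n (≤-trans ih (+-monoʳ-≤ _ (n≤1+n _)))
... | yes _ | no  _ | yes _ = s≤s ih
... | yes _ | no  _ | no  _ = m≤n⇒m≤1+n ih
... | no  _ | yes _ | yes _ = ≤-trans (s≤s ih) (≤-reflexive (sym (+-suc _ _)))
... | no  _ | yes _ | no  _ = ≤-trans ih (+-monoʳ-≤ _ (n≤1+n _))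
... | no ¬p | no ¬q | yes r = [ (λ p → contradiction p ¬p) , (λ q → contradiction q ¬q) ]′ (f zero r)
... | no  _ | no  _ | no  _ = ih

#-pack : {P Q R : Pred (Fin n) 0ℓ} (P? : Decidable P) (Q? : Decidable Q) (R? : Decidable R) →
         (∀ i → P i → R i) → (∀ i → Q i → R i) → (∀ i → P i → ¬ Q i) →
         # P? + # Q? ≤ # R?
#-pack {zero}  P? Q? R? f g h = z≤n
#-pack {suc n} P? Q? R? f g h
  with ih ← #-pack (P? ∘ suc) (Q? ∘ suc) (R? ∘ suc) (f ∘ suc) (g ∘ suc) (h ∘ suc)
  with P? zero | Q? zero | R? zero
... | yes p | yes q | _     = contradiction q (h zero p)
... | yes p | no  _ | yes _ = s≤s ih
... | yes p | no  _ | no ¬r = contradiction (f zero p) ¬r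
... | no  _ | yes q | yes _ = ≤-trans (≤-reflexive (+-suc _ _)) (s≤s ih)
... | no  _ | yes q | no ¬r = contradiction (g zero q) ¬r
... | no  _ | no  _ | yes _ = m≤n⇒m≤1+n ih
... | no  _ | no  _ | no  _ = ih

#-∅ : {P : Pred (Fin n) 0ℓ} (P? : Decidable P) → (∀ i → ¬ P i) → # P? ≡ 0
#-∅ {zero}  P? f = refl
#-∅ {suc n} P? f with P? zero
... | yes p = contradiction p (f zero)
... | no  _ = #-∅ (P? ∘ suc) (f ∘ suc)

#-mono : {P Q : Pred (Fin n) 0ℓ} (P? : Decidable P) (Q? : Decidable Q) → (∀ i → P i → Q i) → # P? ≤ # Q?
#-mono {n = zero}  P? Q? f = z≤n
#-mono {n = suc n} P? Q? f
  with ih ← #-mono (P? ∘ suc) (Q? ∘ suc) (f ∘ suc)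
  with P? zero | Q? zero
... | yes _ | yes _ = s≤s ih
... | yes p | no ¬q = contradiction (f zero p) ¬q
... | no  _ | yes _ = m≤n⇒m≤1+n ih
... | no  _ | no  _ = ih

#-cong : {P Q : Pred (Fin n) 0ℓ} (P? : Decidable P) (Q? : Decidable Q) → (∀ i → P i → Q i) → (∀ i → Q i → P i) →
         # P? ≡ # Q?
#-cong P? Q? f g = ≤-antisym (#-mono P? Q? f) (#-mono Q? P? g)

#-split : {P Q R : Pred (Fin n) 0ℓ} (P? : Decidable P) (Q? : Decidable Q) (R? : Decidable R) →
          (∀ i → R i → P i ⊎ Q i) → (∀ i → P i → R i) → (∀ i → Q i → R i) →
          (∀ i → P i → ¬ Q i) → # R? ≡ # P? + # Q?
#-split P? Q? R? f g h k = ≤-antisym (#-cover P? Q? R? f) (#-pack P? Q? R? g h k)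

#≤n : {P : Pred (Fin n) 0ℓ} (P? : Decidable P) → # P? ≤ n
#≤n {n = zero}  P? = z≤n
#≤n {n = suc n} P? with P? zero
... | yes _ = s≤s (#≤n (P? ∘ suc))
... | no  _ = m≤n⇒m≤1+n (#≤n (P? ∘ suc))

#-singleton : (v : Fin n) → # (Fin._≟ v) ≡ 1
#-singleton {suc n} zero = cong suc (#-∅ ((Fin._≟ zero) ∘ suc {n}) λ _ ())
#-singleton {suc n} (suc v) = trans (#-cong ((Fin._≟ suc v) ∘ suc) (Fin._≟ v)
  (λ _ → Fin.suc-injective) (λ _ → cong suc)) (#-singleton v)

#-unique : {P : Pred (Fin n) 0ℓ} (P? : Decidable P) (v : Fin n) → (∀ i → P i → i ≡ v) → P v → # P? ≡ 1
#-unique P? v f p = trans (#-cong P? (Fin._≟ v) f λ { _ refl → p }) (#-singleton v)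

#-<mono : {P Q : Pred (Fin n) 0ℓ} (P? : Decidable P) (Q? : Decidable Q) → (∀ i → P i → Q i) →
          (v : Fin n) → Q v → ¬ P v → # P? < # Q?
#-<mono P? Q? f v q ¬p = subst (λ k → k + # P? ≤ # Q?) (#-singleton v)
  (#-pack (Fin._≟ v) P? Q? (λ { _ refl → q }) f (λ { _ refl → ¬p }))

#-witness : {P : Pred (Fin n) 0ℓ} (P? : Decidable P) → 1 ≤ # P? → ∃ P
#-witness P? le with Fin.any? P?
... | yes w = w
... | no ¬w = contradiction (subst (1 ≤_) (#-∅ P? (λ i p → ¬w (i , p))) le) λ ()

count-# : ∀ {A : Set} {P : Pred A 0ℓ} (P? : Decidable P) (xs : Vec A n) →
          count P? xs ≡ # (P? ∘ lookup xs)
count-# P? [] = refl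
count-# P? (x ∷ xs) with P? x
... | yes _ = cong suc (count-# P? xs)
... | no  _ = count-# P? xs

-- If a value `i` had no preimage, `punchOut` would inject `Fin (suc m)` into `Fin m`. The given
-- function becomes the direction `⟨$⟩ˡ`, from nodes to slots, because a sort is described by the
-- slot of each node.
injective⇒permutation : (f : Fin n → Fin n) → (∀ {i j} → f i ≡ f j → i ≡ j) →
  Σ[ π ∈ Permutation′ n ] (∀ v → π ⟨$⟩ˡ v ≡ f v)
injective⇒permutation {zero} f inj = permutation f f (λ ()) (λ ()) , λ _ → refl
injective⇒permutation {suc m} f inj = permutation g f fg gf , λ _ → refl
  where
  onto : (i : Fin (suc m)) → ∃ λ v → f v ≡ i
  onto i with Fin.any? (λ v → f v Fin.≟ i)
  ... | yes w = w
  ... | no ¬w = contradiction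
    (Fin.injective⇒≤ {f = λ v → punchOut {i = i} {f v} λ e → ¬w (v , sym e)}
      λ {x} {y} e → inj (Fin.punchOut-injective
        (λ e → ¬w (x , sym e)) (λ e → ¬w (y , sym e)) e)) 1+n≰n
  g : Fin (suc m) → Fin (suc m)
  g = proj₁ ∘ onto
  gf : ∀ i → f (g i) ≡ i
  gf = proj₂ ∘ onto
  fg : ∀ v → g (f v) ≡ v
  fg v = inj (gf (f v))

unique-⊆⇒length≤ : ∀ {A : Set} {xs ys : List A} → Unique xs → (∀ {x} → x ∈ xs → x ∈ ys) →
                   length xs ≤ length ys
unique-⊆⇒length≤ [] f = z≤n
unique-⊆⇒length≤ {A} {x ∷ xs} (x∉ ∷ u) f with ∈-∃++ (f (here refl))
... | as , bs , refl = begin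
  suc (length xs)         ≤⟨ s≤s (unique-⊆⇒length≤ u g) ⟩
  suc (length (as ++ bs)) ≡⟨ cong suc (length-++ as) ⟩
  suc (length as + length bs) ≡⟨ +-suc _ _ ⟨
  length as + suc (length bs) ≡⟨ length-++ as ⟨
  length (as ++ x ∷ bs)   ∎
  where
  open ≤-Reasoning
  g : ∀ {y} → y ∈ xs → y ∈ as ++ bs
  g y∈ with ∈-++⁻ as (f (there y∈))
  ... | inj₁ y∈as = ∈-++⁺ˡ y∈as
  ... | inj₂ (here refl) = contradiction refl (All.lookup x∉ y∈)
  ... | inj₂ (there y∈bs) = ∈-++⁺ʳ as y∈bs

distinct≤ : ∀ xs ys → (∀ {x} → x ∈ xs → x ∈ ys) → distinct xs ≤ length ys
distinct≤ xs ys f = unique-⊆⇒length≤ (deduplicate-! _≟_ xs) (f ∘ ∈-deduplicate⁻ _≟_ xs)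

≤distinct : ∀ xs ys → Unique xs → (∀ {x} → x ∈ xs → x ∈ ys) → length xs ≤ distinct ys
≤distinct xs ys u f = unique-⊆⇒length≤ u (∈-deduplicate⁺ _≟_ ∘ f)

-- Rooted trees

-- An irrelevant field can only be accessed by matching on the record.
reachesRoot-elim : ∀ {N} (t : Tree N) {Q : Fin N → Set} → Decidable Q →
  (∀ v → ∃[ k ] fold v (parent t) k ≡ root t → Q v) → ∀ v → Q v
reachesRoot-elim record { reachesRoot = r } Q? f v = recompute (Q? v) (f v (r v))

module Rooted {N : ℕ} (t : Tree N) where

  private
    par : Fin N → Fin N
    par = parent t

  up : ℕ → Fin N → Fin N
  up k v = fold v par k

  up-parent : ∀ k v → up k (par v) ≡ up (suc k) v
  up-parent zero    v = refl
  up-parent (suc k) v = cong par (up-parent k v)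

  up-+ : ∀ j k v → up (j + k) v ≡ up j (up k v)
  up-+ zero    k v = refl
  up-+ (suc j) k v = cong par (up-+ j k v)

  up-root : ∀ k → up k (root t) ≡ root t
  up-root zero    = refl
  up-root (suc k) = trans (cong par (up-root k)) (root-parent t)

  private
    rounds : ℕ → Fin N → ℕ
    rounds zero    v = 0
    rounds (suc f) v with v Fin.≟ root t
    ... | yes _ = 0
    ... | no  _ = suc (rounds f (par v))

    up-rounds : ∀ k v → up k v ≡ root t → up (rounds k v) v ≡ root t
    up-rounds zero    v e = e
    up-rounds (suc k) v e with v Fin.≟ root t
    ... | yes v≡r = v≡r
    ... | no  _ = trans (sym (up-parent (rounds k (par v)) v)) (up-rounds k (par v) (trans (up-parent k v) e))

    rounds-least : ∀ k v j → up j v ≡ root t → rounds k v ≤ j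
    rounds-least zero    v j e = z≤n
    rounds-least (suc k) v j e with v Fin.≟ root t
    ... | yes _ = z≤n
    rounds-least (suc k) v zero    e | no v≢r = contradiction e v≢r
    rounds-least (suc k) v (suc j) e | no _ = s≤s (rounds-least k (par v) j (trans (up-parent j v) e))

    -- Lets the fixed fuel `N` of `depth` be exchanged for the length of whatever way to the root is
    -- at hand.
    rounds-stable : ∀ k f g v → up k v ≡ root t → k ≤ f → k ≤ g → rounds f v ≡ rounds g v
    rounds-stable k zero zero v e _ _ = refl
    rounds-stable zero zero (suc g) v e _ _ with v Fin.≟ root t
    ... | yes _ = refl
    ... | no v≢r = contradiction e v≢r
    rounds-stable zero (suc f) zero v e _ _ with v Fin.≟ root t
    ... | yes _ = refl
    ... | no v≢r = contradiction e v≢r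
    rounds-stable k (suc f) (suc g) v e k≤f k≤g with v Fin.≟ root t
    ... | yes _ = refl
    rounds-stable zero (suc f) (suc g) v e k≤f k≤g | no v≢r = contradiction e v≢r
    rounds-stable (suc k) (suc f) (suc g) v e (s≤s k≤f) (s≤s k≤g) | no _ =
      cong suc (rounds-stable k f g (par v) (trans (up-parent k v) e) k≤f k≤g)

    -- If the least number d of steps to the root were at least N, two of the
    -- first N + 1 ancestors would coincide, which yields a shorter way.
    reaches-early : ∀ v → ∃[ k ] up k v ≡ root t → ∃[ i ] up (toℕ {N} i) v ≡ root t
    reaches-early v (k , e) with rounds k v <? N
    ... | yes d<N = fromℕ< d<N ,
      trans (cong (λ i → up i v) (Fin.toℕ-fromℕ< d<N)) (up-rounds k v e)
    ... | no d≮N with Fin.pigeonhole (n<1+n N) (λ i → up (toℕ i) v)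
    ... | i , j , i<j , eq = contradiction (rounds-least k v _ short) (<⇒≱ shorter)
      where
      d = rounds k v
      j≤d : toℕ j ≤ d
      j≤d = ≤-trans (Fin.toℕ≤pred[n] j) (≮⇒≥ d≮N)
      short : up ((d ∸ toℕ j) + toℕ i) v ≡ root t
      short = trans (up-+ (d ∸ toℕ j) (toℕ i) v) (trans (cong (up (d ∸ toℕ j)) eq)
        (trans (sym (up-+ (d ∸ toℕ j) (toℕ j) v)) (trans (cong (λ i → up i v) (m∸n+n≡m j≤d)) (up-rounds k v e))))
      shorter : (d ∸ toℕ j) + toℕ i < d
      shorter = <-≤-trans (+-monoʳ-< (d ∸ toℕ j) i<j) (≤-reflexive (m∸n+n≡m j≤d))

    -- The reachability witness is irrelevant, so a number can be drawn from it only through a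
    -- decidable statement. Bounding the number of steps by `N` makes the existence decidable by
    -- search.
    reaches : ∀ v → ∃[ i ] up (toℕ {N} i) v ≡ root t
    reaches = reachesRoot-elim t (λ v → Fin.any? (λ i → up (toℕ i) v Fin.≟ root t)) reaches-early

  depth : Fin N → ℕ
  depth v = rounds N v

  private
    up-depth : ∀ v → up (depth v) v ≡ root t
    up-depth v with reaches v
    ... | i , e = trans (cong (λ k → up k v)
      (rounds-stable (toℕ i) N (toℕ i) v e (<⇒≤ (Fin.toℕ<n i)) ≤-refl)) (up-rounds (toℕ i) v e)

  depth<N : ∀ v → depth v < N
  depth<N v with reaches v
  ... | i , e = ≤-<-trans (rounds-least N v _ e) (Fin.toℕ<n i)

  depth-root : depth (root t) ≡ 0
  depth-root = n≤0⇒n≡0 (rounds-least N (root t) 0 refl)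

  depth-suc : ∀ {v} → v ≢ root t → depth v ≡ suc (depth (par v))
  depth-suc {v} v≢r = ≤-antisym
    (rounds-least N v _ (trans (sym (up-parent (depth (par v)) v)) (up-depth (par v))))
    (lower (depth v) (up-depth v))
    where
    lower : ∀ k → up k v ≡ root t → suc (depth (par v)) ≤ k
    lower zero    e = contradiction e v≢r
    lower (suc k) e = s≤s (rounds-least N (par v) k (trans (up-parent k v) e))

  depth>0⇒≢root : ∀ {v} → 0 < depth v → v ≢ root t
  depth>0⇒≢root 0<d refl = contradiction depth-root (>⇒≢ 0<d)

  depth-parent : ∀ v → depth (par v) ≡ depth v ∸ 1
  depth-parent v with v Fin.≟ root t
  ... | yes refl = trans (cong depth (root-parent t)) (trans depth-root (cong (_∸ 1) (sym depth-root)))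
  ... | no  v≢r  = cong (_∸ 1) (sym (depth-suc v≢r))

  depth-up : ∀ k v → depth (up k v) ≡ depth v ∸ k
  depth-up zero    v = refl
  depth-up (suc k) v = trans (depth-parent (up k v)) (trans (cong (_∸ 1) (depth-up k v))
    (trans (∸-+-assoc (depth v) k 1) (cong (depth v ∸_) (+-comm k 1))))

  infix 4 _⊒_ _⊐_ _⊒?_ _⊐?_

  -- v ⊒ u : v is an ancestor of u or u itself.
  record _⊒_ (v u : Fin N) : Set where
    constructor climb
    field climbs : up (depth u ∸ depth v) u ≡ v

  open _⊒_

  _⊐_ : Fin N → Fin N → Set
  v ⊐ u = v ⊒ u × depth v < depth u

  _⊒?_ : ∀ v u → Dec (v ⊒ u)
  v ⊒? u = map′ climb climbs (up (depth u ∸ depth v) u Fin.≟ v)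

  _⊐?_ : ∀ v u → Dec (v ⊐ u)
  v ⊐? u = (v ⊒? u) ×-dec (depth v <? depth u)

  ⊒-refl : ∀ {v} → v ⊒ v
  ⊒-refl {v} = climb (cong (λ k → up k v) (n∸n≡0 (depth v)))

  ⊒⇒depth≤ : ∀ {v u} → v ⊒ u → depth v ≤ depth u
  ⊒⇒depth≤ {v} {u} (climb e) = begin
    depth v                               ≡⟨ cong depth e ⟨
    depth (up (depth u ∸ depth v) u)      ≡⟨ depth-up (depth u ∸ depth v) u ⟩
    depth u ∸ (depth u ∸ depth v)         ≤⟨ m∸n≤m (depth u) (depth u ∸ depth v) ⟩
    depth u                               ∎
    where open ≤-Reasoning

  ⊒∧depth≡⇒≡ : ∀ {v u} → v ⊒ u → depth v ≡ depth u → u ≡ v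
  ⊒∧depth≡⇒≡ {v} {u} (climb e) d =
    trans (cong (λ k → up k u) (sym (trans (cong (depth u ∸_) d) (n∸n≡0 (depth u))))) e

  ⊒-unique : ∀ {v w u} → v ⊒ u → w ⊒ u → depth v ≡ depth w → v ≡ w
  ⊒-unique {u = u} (climb e) (climb f) d = trans (sym e) (trans (cong (λ k → up (depth u ∸ k) u) d) f)

  ⊒-trans : ∀ {w v u} → w ⊒ v → v ⊒ u → w ⊒ u
  ⊒-trans {w} {v} {u} w⊒v@(climb f) v⊒u@(climb e) = climb (begin
    up (depth u ∸ depth w) u                                ≡⟨ cong (λ k → up k u) split ⟨
    up ((depth v ∸ depth w) + (depth u ∸ depth v)) u
      ≡⟨ up-+ (depth v ∸ depth w) (depth u ∸ depth v) u ⟩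
    up (depth v ∸ depth w) (up (depth u ∸ depth v) u)       ≡⟨ cong (up (depth v ∸ depth w)) e ⟩
    up (depth v ∸ depth w) v                                ≡⟨ f ⟩
    w                                                       ∎)
    where
    open ≡-Reasoning
    split : (depth v ∸ depth w) + (depth u ∸ depth v) ≡ depth u ∸ depth w
    split = trans (sym (+-∸-comm (depth u ∸ depth v) (⊒⇒depth≤ w⊒v)))
                  (cong (_∸ depth w) (m+[n∸m]≡n (⊒⇒depth≤ v⊒u)))

  parent⊒ : ∀ u → par u ⊒ u
  parent⊒ u with u Fin.≟ root t
  ... | yes refl = subst (_⊒ root t) (sym (root-parent t)) ⊒-refl
  ... | no  u≢r  = climb (cong (λ k → up k u)
    (trans (cong (_∸ depth (par u)) (depth-suc u≢r)) (m+n∸n≡m 1 (depth (par u)))))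

  ⊐-parent : ∀ {v u} → v ⊐ u → v ⊒ par u
  ⊐-parent {v} {u} (climb e , d) = climb (trans (up-parent (depth (par u) ∸ depth v) u) (trans (cong (λ k → up k u) eq) e))
    where
    du : depth u ≡ suc (depth (par u))
    du = depth-suc (depth>0⇒≢root (≤-<-trans z≤n d))
    eq : suc (depth (par u) ∸ depth v) ≡ depth u ∸ depth v
    eq = trans (sym (+-∸-assoc 1 (s≤s⁻¹ (subst (depth v <_) du d)))) (cong (_∸ depth v) (sym du))

  ⊒⇒≡⊎⊐ : ∀ {v u} → v ⊒ u → u ≡ v ⊎ v ⊐ u
  ⊒⇒≡⊎⊐ e with m≤n⇒m<n∨m≡n (⊒⇒depth≤ e)
  ... | inj₁ d = inj₂ (e , d)
  ... | inj₂ d = inj₁ (⊒∧depth≡⇒≡ e d)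

  child-depth : ∀ {w v} → Child t w v → depth w ≡ suc (depth v)
  child-depth (w≢r , refl) = depth-suc w≢r

  child⊐ : ∀ {w v} → Child t w v → v ⊐ w
  child⊐ {w} (w≢r , refl) = parent⊒ w , ≤-reflexive (sym (depth-suc w≢r))

  ⊐-child : ∀ {v u} → v ⊐ u → ∃[ w ] (Child t w v × w ⊒ u)
  ⊐-child {v} {u} (climb e , d) = w , (depth>0⇒≢root (subst (0 <_) (sym dw) z<s) , pw) ,
    climb (cong (λ k → up (depth u ∸ k) u) dw)
    where
    w = up (depth u ∸ suc (depth v)) u
    dw : depth w ≡ suc (depth v)
    dw = trans (depth-up (depth u ∸ suc (depth v)) u) (m∸[m∸n]≡n d)
    pw : par w ≡ v
    pw = trans (cong (λ k → up k u) (sym (+-∸-assoc 1 d))) e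

  root⊒ : ∀ v → root t ⊒ v
  root⊒ v = climb (trans (cong (λ k → up (depth v ∸ k) v) depth-root) (up-depth v))

  ⊒-⊐-trans : ∀ {w v u} → w ⊒ v → v ⊐ u → w ⊐ u
  ⊒-⊐-trans e (f , d) = ⊒-trans e f , ≤-<-trans (⊒⇒depth≤ e) d

  ⊐-⊒-trans : ∀ {w v u} → w ⊐ v → v ⊒ u → w ⊐ u
  ⊐-⊒-trans (e , d) f = ⊒-trans e f , <-≤-trans d (⊒⇒depth≤ f)

  ⊒⇒∈path : ∀ {v u} → v ⊒ u → v ∈ pathToRoot t u
  ⊒⇒∈path {v} {u} (climb e) = subst (_∈ pathToRoot t u) e
    (go N (depth u ∸ depth v) u (≤-<-trans (m∸n≤m (depth u) (depth v)) (depth<N u)))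
    where
    go : ∀ n k u → k < n → up k u ∈ List.iterate par u n
    go (suc n) zero    u _ = here refl
    go (suc n) (suc k) u (s≤s lt) = there (subst (_∈ List.iterate par (par u) n) (up-parent k u) (go n k (par u) lt))

-- Greedy levels, the lower bound, and the cost of refined orders

module Levels {N : ℕ} (t : Tree N) where

  open Rooted t

  private
    par : Fin N → Fin N
    par = parent t

  -- The blocks are the connected components of the level sets of h.
  record Greedy (b : ℕ) (h : Fin N → ℕ) : Set where
    field
      monotone : ∀ v → h v ≤ h (par v)
      small    : ∀ v → # (λ u → (v ⊒? u) ×-dec (h u ≟ h v)) ≤ b
      blocked  : ∀ v → (∃[ w ] (Child t w v × h w ≡ h v)) ⊎
                 ((∀ w → Child t w v → h w < h v) ×
                  (∀ k → h v ≡ suc k → b ≤ # (λ u → (v ⊐? u) ×-dec (h u ≟ k))))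

  monotone⇒⊒ : ∀ {h : Fin N → ℕ} → (∀ v → h v ≤ h (par v)) → ∀ {v u} → v ⊒ u → h u ≤ h v
  monotone⇒⊒ {h} mono {v} {u} (climb e) = subst (λ x → h u ≤ h x) e (go (depth u ∸ depth v))
    where
    go : ∀ k → h u ≤ h (up k u)
    go zero    = ≤-refl
    go (suc k) = ≤-trans (go k) (mono (up k u))

  -- Lower bound on the cost of an arbitrary layout

  module LowerBound {b} {h : Fin N → ℕ} (G : Greedy b h) (0<b : 0 < b)
    (blk : Fin N → ℕ) where

    open Greedy G

    Bottom : Fin N → Set
    Bottom v = ∀ u → v ⊐ u → h u < h v

    -- Following children of equal level must stop, since the depth grows, and it stops at a node
    -- that opened its level. There `blocked` supplies the `b` nodes of the previous level that
    -- `descend` consumes.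
    find-bottom : ∀ v → ∃[ u ] (v ⊒ u × h u ≡ h v × Bottom u ×
      (∀ k → h u ≡ suc k → b ≤ # (λ x → (u ⊐? x) ×-dec (h x ≟ k))))
    find-bottom v = go (N ∸ depth v) v ≤-refl
      where
      go : ∀ f v → N ∸ depth v ≤ f → ∃[ u ] (v ⊒ u × h u ≡ h v × Bottom u ×
        (∀ k → h u ≡ suc k → b ≤ # (λ x → (u ⊐? x) ×-dec (h x ≟ k))))
      go f v le with blocked v
      ... | inj₂ (lt , many) = v , ⊒-refl , refl , bottom , many
        where
        bottom : Bottom v
        bottom u s with ⊐-child s
        ... | w , c , w⊒u = ≤-<-trans (monotone⇒⊒ monotone w⊒u) (lt w c)
      go zero v le | inj₁ _ = contradiction (≤-trans (m<n⇒0<n∸m (depth<N v)) le) λ ()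
      go (suc f) v le | inj₁ (w , c , e)
        with go f w (s≤s⁻¹ (<-≤-trans (∸-monoʳ-< (proj₂ (child⊐ c)) (<⇒≤ (depth<N w))) le))
      ... | u , w⊒u , e′ , rest = u , ⊒-trans (proj₁ (child⊐ c)) w⊒u , trans e′ e , rest

    hits? : ∀ v (F : List ℕ) → Decidable (λ u → v ⊐ u × blk u ∈ F)
    hits? v F u = (v ⊐? u) ×-dec (blk u ∈? F)

    -- F lists the blocks met so far.  Each time the descent passes a region of
    -- at least b nodes, either the region holds a node in a new block, through
    -- which the path is led, or all of it lies in blocks of F, using up b of the
    -- places those blocks offer.
    descend : ∀ k v → h v ≡ k → Bottom v →
      (∀ k → h v ≡ suc k → b ≤ # (λ x → (v ⊐? x) ×-dec (h x ≟ k))) → (F : List ℕ) →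
      ∃[ ℓ ] ∃[ X ] (Leaf t ℓ × v ⊒ ℓ × Unique X × All (_∉ F) X ×
        All (λ x → ∃[ y ] (y ⊒ ℓ × blk y ≡ x)) X ×
        b * k ≤ b * length X + # (hits? v (X ++ F)))
    descend zero v hv bot many F = v , [] , leaf , ⊒-refl , [] , [] , [] ,
      ≤-trans (≤-reflexive (*-zeroʳ b)) z≤n
      where
      leaf : Leaf t v
      leaf (w , c) = contradiction (subst (h w <_) hv (bot w (child⊐ c))) λ ()
    descend (suc k) v hv bot many F
      with Fin.any? (λ u → ((v ⊐? u) ×-dec (h u ≟ k)) ×-dec ¬? (blk u ∈? F))
    ... | yes (w , (v⊐w , hw) , new)
      -- The path goes on from `w` to a node that opened level `k`, for only there is a full region
      -- of level `k - 1` guaranteed.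
      with u , w⊒u , hu , botu , manyu ← find-bottom w
      with ℓ , X , leaf , u⊒ℓ , uniq , fresh , onpath , bound ←
             descend k u (trans hu hw) botu manyu (blk w ∷ F)
      = ℓ , blk w ∷ X , leaf , ⊒-trans (proj₁ v⊐w) (⊒-trans w⊒u u⊒ℓ) ,
        All.map (λ x∉ e → x∉ (here (sym e))) fresh ∷ uniq ,
        new ∷ All.map (λ x∉ x∈ → x∉ (there x∈)) fresh ,
        (w , ⊒-trans w⊒u u⊒ℓ , refl) ∷ onpath ,
        (begin
          b * suc k                                        ≡⟨ *-suc b k ⟩
          b + b * k                                        ≤⟨ +-monoʳ-≤ b bound ⟩
          b + (b * length X + # (hits? u (X ++ blk w ∷ F))) ≡⟨ +-assoc b _ _ ⟨
          b + b * length X + # (hits? u (X ++ blk w ∷ F))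
            ≡⟨ cong (_+ # (hits? u (X ++ blk w ∷ F))) (*-suc b (length X)) ⟨
          b * suc (length X) + # (hits? u (X ++ blk w ∷ F))
            ≤⟨ +-monoʳ-≤ (b * suc (length X)) (#-mono (hits? u (X ++ blk w ∷ F)) (hits? v (blk w ∷ X ++ F)) (λ i (u⊐i , i∈) → ⊒-⊐-trans (⊒-trans (proj₁ v⊐w) w⊒u) u⊐i , shuffle i∈)) ⟩
          b * suc (length X) + # (hits? v (blk w ∷ X ++ F)) ∎)
      where
      open ≤-Reasoning
      shuffle : ∀ {x} → x ∈ X ++ blk w ∷ F → x ∈ blk w ∷ X ++ F
      shuffle x∈ with ∈-++⁻ X x∈
      ... | inj₁ x∈X         = there (∈-++⁺ˡ x∈X)
      ... | inj₂ (here e)    = here e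
      ... | inj₂ (there x∈F) = there (∈-++⁺ʳ X x∈F)
    descend (suc k) v hv bot many F | no ¬new
      with w , v⊐w , hw ← #-witness (λ x → (v ⊐? x) ×-dec (h x ≟ k)) (≤-trans 0<b (many k hv))
      with u , w⊒u , hu , botu , manyu ← find-bottom w
      with ℓ , X , leaf , u⊒ℓ , uniq , fresh , onpath , bound ←
             descend k u (trans hu hw) botu manyu F
      = ℓ , X , leaf , ⊒-trans (proj₁ v⊐w) (⊒-trans w⊒u u⊒ℓ) , uniq , fresh , onpath ,
        (begin
          b * suc k                                        ≡⟨ *-suc b k ⟩
          b + b * k                                        ≤⟨ +-mono-≤ (many k hv) bound ⟩
          # region? + (b * length X + # (hits? u (X ++ F))) ≡⟨ +-comm (# region?) _ ⟩
          b * length X + # (hits? u (X ++ F)) + # region?   ≡⟨ +-assoc (b * length X) _ _ ⟩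
          b * length X + (# (hits? u (X ++ F)) + # region?)
            -- Strictly below `u` all levels are less than `k`, so the later hits are disjoint from
            -- this region and the two counts add up.
            ≤⟨ +-monoʳ-≤ (b * length X) (#-pack (hits? u (X ++ F)) region? (hits? v (X ++ F)) below seen disjoint) ⟩
          b * length X + # (hits? v (X ++ F))               ∎)
      where
      open ≤-Reasoning
      region? : Decidable (λ x → v ⊐ x × h x ≡ k)
      region? x = (v ⊐? x) ×-dec (h x ≟ k)
      below : ∀ i → u ⊐ i × blk i ∈ X ++ F → v ⊐ i × blk i ∈ X ++ F
      below i (u⊐i , i∈) = ⊒-⊐-trans (⊒-trans (proj₁ v⊐w) w⊒u) u⊐i , i∈
      seen : ∀ i → v ⊐ i × h i ≡ k → v ⊐ i × blk i ∈ X ++ F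
      seen i r with blk i ∈? F
      ... | yes i∈ = proj₁ r , ∈-++⁺ʳ X i∈
      ... | no  i∉ = contradiction (i , r , i∉) ¬new
      disjoint : ∀ i → u ⊐ i × blk i ∈ X ++ F → ¬ (v ⊐ i × h i ≡ k)
      disjoint i (u⊐i , _) (_ , hi) = <-irrefl (trans hi (sym (trans hu hw))) (botu i u⊐i)

    #-blocks : ∀ {B} → (∀ j → # (λ u → blk u ≟ j) ≤ B) → ∀ X → # (λ u → blk u ∈? X) ≤ length X * B
    #-blocks le [] = ≤-reflexive (#-∅ (λ u → blk u ∈? []) λ _ ())
    #-blocks le (x ∷ X) = ≤-trans
      (#-cover (λ u → blk u ≟ x) (λ u → blk u ∈? X) (λ u → blk u ∈? (x ∷ X))
        (λ { _ (here e) → inj₁ e ; _ (there u∈) → inj₂ u∈ }))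
      (+-mono-≤ (le x) (#-blocks le X))

    -- With no blocks met at the start, `descend` gives `b * h` at most `b * length X` plus the
    -- number of nodes in the blocks of `X`, which is at most `2 * b * length X`. Hence `h` is at
    -- most three times the cost, and the missing 1 is paid by the cost itself, which is positive.
    levels≤4cost : (∀ j → # (λ u → blk u ≟ j) ≤ b + b) → suc (h (root t)) ≤ 4 * maxBlockCost t blk
    levels≤4cost le
      with u , _ , hu , botu , manyu ← find-bottom (root t)
      with ℓ , X , leaf , _ , uniq , _ , onpath , bound ← descend (h (root t)) u hu botu manyu []
      = begin
        1 + h (root t)     ≤⟨ +-mono-≤ nonempty height ⟩
        cost + 3 * cost    ∎
      where
      open ≤-Reasoning
      path = List.map blk (pathToRoot t ℓ)
      cost = maxBlockCost t blk
      path≤cost : distinct path ≤ cost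
      path≤cost = v≤max⁺ 0 _ (inj₂ (Any.map (λ { refl → ≤-refl })
        (∈-map⁺ (λ v → distinct (List.map blk (pathToRoot t v)))
          (∈-filter⁺ (leaf? t) (∈-allFin ℓ) leaf))))
      X⊆path : ∀ {x} → x ∈ X → x ∈ path
      X⊆path x∈ with All.lookup onpath x∈
      ... | y , y⊒ℓ , refl = ∈-map⁺ blk (⊒⇒∈path y⊒ℓ)
      X≤cost : length X ≤ cost
      X≤cost = ≤-trans (≤distinct X path uniq X⊆path) path≤cost
      nonempty : 1 ≤ cost
      nonempty = ≤-trans (≤distinct (blk ℓ ∷ []) path ([] ∷ []) λ { (here refl) → ∈-map⁺ blk (⊒⇒∈path ⊒-refl) }) path≤cost
      height : h (root t) ≤ 3 * cost
      height = *-cancelˡ-≤ b {{>-nonZero 0<b}} (begin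
        b * h (root t)                                    ≤⟨ bound ⟩
        b * length X + # (hits? u (X ++ []))
          ≤⟨ +-monoʳ-≤ (b * length X) (#-mono (hits? u (X ++ [])) (λ x → blk x ∈? X) (λ { i (_ , i∈) → [ id , (λ ()) ]′ (∈-++⁻ X i∈) })) ⟩
        b * length X + # (λ x → blk x ∈? X)               ≤⟨ +-monoʳ-≤ (b * length X) (#-blocks le X) ⟩
        b * length X + length X * (b + b)
          ≡⟨ cong (b * length X +_) (trans (*-comm (length X) (b + b)) (*-distribʳ-+ (length X) b b)) ⟩
        b * length X + (b * length X + b * length X)
          ≡⟨ cong (λ z → b * length X + (b * length X + z)) (+-identityʳ _) ⟨
        3 * (b * length X)                                ≡⟨ *-assoc 3 b (length X) ⟨
        3 * b * length X                                  ≡⟨ cong (_* length X) (*-comm 3 b) ⟩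
        b * 3 * length X                                  ≡⟨ *-assoc b 3 (length X) ⟩
        b * (3 * length X)                                ≤⟨ *-monoʳ-≤ b (*-monoʳ-≤ 3 X≤cost) ⟩
        b * (3 * cost)                                    ∎)

  -- Pieces of an order and the memory blocks they meet

  slot : Permutation′ N → Fin N → ℕ
  slot π v = toℕ (π ⟨$⟩ˡ v)

  node : Permutation′ N → Fin N → ℕ
  node π i = toℕ (π ⟨$⟩ʳ i)

  -- A certificate that the pieces E of the order π are short and few on each
  -- path: Φ bounds the number of pieces, and the current threshold q pays for
  -- the levels that may still be added.
  record Pieces (π : Permutation′ N) (w q G : ℕ) : Set where
    field
      Φ        : Fin N → ℕ
      E        : Fin N → List (Fin N)
      monotone : ∀ v → Φ v ≤ Φ (par v)
      same     : ∀ v → Φ v ≡ Φ (par v) → E v ≡ E (par v)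
      short    : ∀ u v → E u ≡ E v → slot π u < slot π v + w
      budget   : Φ (root t) + 1 + q ≤ G + G

  neighbours : ∀ {a b} → a ≤ suc b → b ≤ suc a → a ∈ pred b ∷ b ∷ suc b ∷ []
  neighbours {a} {b} le ge with <-cmp a b
  ... | tri< a<b _ _  = here (cong pred (≤-antisym a<b ge))
  ... | tri≈ _ a≡b _  = there (here a≡b)
  ... | tri> _ _ b<a  = there (there (here (≤-antisym le b<a)))

  -- Two nodes of a piece are fewer than `w ≤ B` slots apart, so under any alignment their memory
  -- blocks are equal or adjacent. Three names around one representative therefore cover a piece,
  -- and a path has at most `Φ (root t) + 1 ≤ G + G` pieces.
  pieces⇒cost : ∀ {π w q G} → Pieces π w q G → ∀ B .{{_ : NonZero B}} (s : Fin B) → w ≤ B →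
                linearCost t π B s ≤ 6 * G
  pieces⇒cost {π} {w} {q} {G} pieces B s w≤B = max≤v⁺ z≤n (All.tabulate each)
    where
    open Pieces pieces
    β : Fin N → ℕ
    β = linearBlock π B s

    near : Fin N → List ℕ
    near r = pred (β r) ∷ β r ∷ suc (β r) ∷ []

    next : ∀ u v → E u ≡ E v → β u ≤ suc (β v)
    next u v e = begin
      (slot π u + toℕ s) / B          ≤⟨ /-monoˡ-≤ B (<⇒≤ (+-monoˡ-< (toℕ s) (short u v e))) ⟩
      (slot π v + w + toℕ s) / B      ≤⟨ /-monoˡ-≤ B (+-monoˡ-≤ (toℕ s) (+-monoʳ-≤ (slot π v) w≤B)) ⟩
      (slot π v + B + toℕ s) / B
        ≡⟨ cong (_/ B) (trans (+-assoc (slot π v) B (toℕ s)) (trans (cong (slot π v +_) (+-comm B (toℕ s))) (sym (+-assoc (slot π v) (toℕ s) B)))) ⟩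
      (slot π v + toℕ s + B) / B      ≡⟨ m/n≡1+[m∸n]/n (m≤n+m B _) ⟩
      suc ((slot π v + toℕ s + B ∸ B) / B) ≡⟨ cong (λ x → suc (x / B)) (m+n∸n≡m _ B) ⟩
      suc (β v)                       ∎
      where open ≤-Reasoning

    Φ≤Φroot : ∀ v → Φ v ≤ Φ (root t)
    Φ≤Φroot v = monotone⇒⊒ monotone (root⊒ v)

    -- `r` represents the piece that the walk upwards is in. While `Φ` stays the same, so does `E`,
    -- and `near r` still covers; when `Φ` grows, a new representative is taken and its three names
    -- are charged to the growth.
    cover : ∀ n r v → E r ≡ E v → ∃[ ys ] (length ys ≤ 3 * (Φ (root t) ∸ Φ v) ×
      (∀ {x} → x ∈ List.map β (List.iterate par v n) → x ∈ near r ++ ys))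
    cover zero    r v e = [] , z≤n , λ ()
    cover (suc n) r v e with Φ v ≟ Φ (par v)
    ... | yes Φ≡ with cover n r (par v) (trans e (same v Φ≡))
    ... | ys , le , f = ys , subst (λ k → length ys ≤ 3 * (Φ (root t) ∸ k)) (sym Φ≡) le , g
      where
      g : ∀ {x} → x ∈ List.map β (List.iterate par v (suc n)) → x ∈ near r ++ ys
      g (here refl) = ∈-++⁺ˡ (neighbours (next v r (sym e)) (next r v e))
      g (there x∈)  = f x∈
    cover (suc n) r v e | no Φ≢ with cover n (par v) (par v) refl
    ... | ys , le , f = near (par v) ++ ys , (begin
        3 + length ys                       ≤⟨ +-monoʳ-≤ 3 le ⟩
        3 + 3 * (Φ (root t) ∸ Φ (par v))    ≡⟨ *-suc 3 _ ⟨
        3 * suc (Φ (root t) ∸ Φ (par v))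
          ≤⟨ *-monoʳ-≤ 3 (∸-monoʳ-< (≤∧≢⇒< (monotone v) Φ≢) (Φ≤Φroot (par v))) ⟩
        3 * (Φ (root t) ∸ Φ v)              ∎) , g
      where
      open ≤-Reasoning
      g : ∀ {x} → x ∈ List.map β (List.iterate par v (suc n)) → x ∈ near r ++ near (par v) ++ ys
      g (here refl) = ∈-++⁺ˡ (neighbours (next v r (sym e)) (next r v e))
      g (there x∈)  = ∈-++⁺ʳ (near r) (f x∈)

    each : ∀ {x} → x ∈ List.map (λ v → distinct (List.map β (pathToRoot t v)))
                          (filter (leaf? t) (allFin N)) → x ≤ 6 * G
    each x∈ with ∈-map⁻ (λ v → distinct (List.map β (pathToRoot t v))) x∈
    ... | v , _ , refl with cover N v v refl
    ... | ys , le , f = begin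
      distinct (List.map β (pathToRoot t v)) ≤⟨ distinct≤ _ (near v ++ ys) f ⟩
      3 + length ys
        ≤⟨ +-monoʳ-≤ 3 (≤-trans le (*-monoʳ-≤ 3 (m∸n≤m (Φ (root t)) (Φ v)))) ⟩
      3 + 3 * Φ (root t)                     ≡⟨ *-suc 3 _ ⟨
      3 * suc (Φ (root t))                   ≡⟨ cong (3 *_) (+-comm (Φ (root t)) 1) ⟨
      3 * (Φ (root t) + 1)                   ≤⟨ *-monoʳ-≤ 3 (≤-trans (m≤m+n _ q) budget) ⟩
      3 * (G + G)                            ≡⟨ cong (λ z → 3 * (G + z)) (+-identityʳ G) ⟨
      3 * (2 * G)                            ≡⟨ *-assoc 3 2 G ⟨
      6 * G                                  ∎
      where open ≤-Reasoning

  -- Every node is a piece of its own, and `N` stands in for the number of levels: `Φ` counts down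
  -- with the depth from `N - 1` at the root, which makes the budget an equality.
  initial-pieces : ∀ π → Pieces π 1 N N
  initial-pieces π = record
    { Φ = λ v → N ∸ suc (depth v)
    ; E = λ v → v ∷ []
    ; monotone = λ v → ∸-monoʳ-≤ N (s≤s (≤-trans (≤-reflexive (depth-parent v)) (m∸n≤m (depth v) 1)))
    ; same = λ v e → cong (_∷ []) (fixed v (suc-injective (∸-cancelˡ-≡ (depth<N v) (depth<N (par v)) e)))
    ; short = λ { u v refl → m<m+n _ z<s }
    ; budget = ≤-reflexive (cong (_+ N) (trans (cong (λ d → N ∸ suc d + 1) depth-root)
        (m∸n+n≡m (≤-<-trans z≤n (depth<N (root t))))))
    }
    where
    fixed : ∀ v → depth v ≡ depth (par v) → v ≡ par v
    fixed v e = ⊒∧depth≡⇒≡ (parent⊒ v) (sym e)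

  -- By monotonicity of the levels the fields force `top v` to be the highest node of the block of
  -- `v`; it serves as the name of the block and as the sorting key.
  record Clustering (b : ℕ) (h : Fin N → ℕ) (top : Fin N → Fin N) : Set where
    field
      greedy  : Greedy b h
      inherit : ∀ v → h v ≡ h (par v) → top v ≡ top (par v)
      top⊒    : ∀ v → top v ⊒ v
      top-h   : ∀ v → h (top v) ≡ h v

    class≤b : ∀ v → # (λ u → top u Fin.≟ top v) ≤ b
    class≤b v = ≤-trans (#-mono (λ u → top u Fin.≟ top v) (λ u → (top v ⊒? u) ×-dec (h u ≟ h (top v)))
      (λ u e → subst (_⊒ u) e (top⊒ u) , trans (sym (top-h u)) (cong h e))) (Greedy.small greedy (top v))

  -- The effect of a stable sort on distances within a key class; that the classes
  -- become contiguous is never needed.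
  record Refines (key : Fin N → Fin N) (π π′ : Permutation′ N) : Set where
    field
      gathers   : ∀ u v → key u ≡ key v → slot π′ u < slot π′ v + # (λ w → key w Fin.≟ key v)
      preserves : ∀ u v → key u ≡ key v → slot π′ u ≤ slot π′ v + (slot π u ∸ slot π v)

  -- From size `b` on, the blocks just sorted are short enough by themselves, so the former pieces
  -- are forgotten and the account starts anew with a budget of exactly twice the number of levels.
  new-level : ∀ {b h top π π′} → Clustering b h top → Refines top π π′ →
    Pieces π′ b (suc (h (root t))) (suc (h (root t)))
  new-level {b} {h} {top} {π} {π′} L S = record
    { Φ = h
    ; E = λ v → top v ∷ []
    ; monotone = Greedy.monotone greedy
    ; same = λ v e → cong (_∷ []) (inherit v e)
    ; short = λ u v e → <-≤-trans (gathers u v (∷-injectiveˡ e)) (+-monoʳ-≤ (slot π′ v) (class≤b v))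
    ; budget = ≤-reflexive (cong (_+ suc (h (root t))) (+-comm (h (root t)) 1))
    }
    where
    open Clustering L
    open Refines S

  -- For smaller sizes each old piece is cut by the new blocks, and `preserves` keeps the parts
  -- short. The new number of levels enters the budget twice, once through `Φ` and once as the next
  -- threshold; the old threshold, at least twice as large, gives way to both.
  add-level : ∀ {b h top π π′ w q G} → Clustering b h top → Refines top π π′ → 0 < w →
    suc (h (root t)) + suc (h (root t)) ≤ q → Pieces π w q G → Pieces π′ w (suc (h (root t))) G
  add-level {b} {h} {top} {π} {π′} {w} {q} {G} L S 0<w le P = record
    { Φ = λ v → Φ v + h v
    ; E = λ v → top v ∷ E v
    ; monotone = λ v → +-mono-≤ (monotone v) (hm v)
    -- Both summands are monotone, so equal sums force equal summands.
    ; same = λ v e → cong₂ _∷_ (inherit v (≤-antisym (hm v) (+-cancelˡ-≤ (Φ v) _ _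
               (≤-trans (+-monoˡ-≤ (h (par v)) (monotone v)) (≤-reflexive (sym e))))))
               (same v (≤-antisym (monotone v) (+-cancelʳ-≤ (h v) _ _
               (≤-trans (+-monoʳ-≤ (Φ (par v)) (hm v)) (≤-reflexive (sym e))))))
    ; short = λ u v e → ≤-<-trans (preserves u v (∷-injectiveˡ e))
               (+-monoʳ-< (slot π′ v) (m<n+o⇒m∸n<o (slot π u) (slot π v) {{>-nonZero 0<w}} (short u v (∷-injectiveʳ e))))
    ; budget = begin
        Φ (root t) + h (root t) + 1 + suc (h (root t))
          ≡⟨ cong (_+ suc (h (root t))) (trans (+-assoc (Φ (root t)) _ 1) (cong (Φ (root t) +_) (+-comm _ 1))) ⟩
        Φ (root t) + suc (h (root t)) + suc (h (root t)) ≡⟨ +-assoc (Φ (root t)) _ _ ⟩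
        Φ (root t) + (suc (h (root t)) + suc (h (root t))) ≤⟨ +-mono-≤ (m≤m+n (Φ (root t)) 1) le ⟩
        Φ (root t) + 1 + q                               ≤⟨ budget ⟩
        G + G                                            ∎
    }
    where
    open Clustering L
    open Refines S
    open Pieces P
    open ≤-Reasoning
    hm = Greedy.monotone greedy

-- Counting sort

module Sorting {N : ℕ} (t : Tree N) where
  open Levels t

  earlier? : (π : Permutation′ N) (f : Fin N → Fin N) (κ : Fin N) (i : ℕ) →
             Decidable (λ u → f u ≡ κ × slot π u < i)
  earlier? π f κ i u = (f u Fin.≟ κ) ×-dec (slot π u <? i)

  slot-injective : ∀ π {u v} → slot π u ≡ slot π v → u ≡ v
  slot-injective π e = trans (sym (inverseʳ π)) (trans (cong (π ⟨$⟩ʳ_) (Fin.toℕ-injective e)) (inverseʳ π))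

  module _ (π : Permutation′ N) (key : Fin N → Fin N) where

    less? : (κ : ℕ) → Decidable (λ u → toℕ (key u) < κ)
    less? κ u = toℕ (key u) <? κ

    equal? : (κ : Fin N) → Decidable (λ u → key u ≡ κ)
    equal? κ u = key u Fin.≟ κ

    #-earlier-hit : ∀ {w} → # (earlier? π key (key w) (suc (slot π w))) ≡ suc (# (earlier? π key (key w) (slot π w)))
    #-earlier-hit {w} = trans
      (#-split (Fin._≟ w) (earlier? π key (key w) (slot π w)) (earlier? π key (key w) (suc (slot π w)))
        (λ i (e , lt) → [ (λ lt′ → inj₂ (e , lt′)) , (λ e′ → inj₁ (slot-injective π e′)) ]′ (m≤n⇒m<n∨m≡n (s≤s⁻¹ lt)))
        (λ { i refl → refl , ≤-refl }) (λ i (e , lt) → e , m≤n⇒m≤1+n lt)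
        (λ { i refl (_ , lt) → <-irrefl refl lt }))
      (cong (_+ # (earlier? π key (key w) (slot π w))) (#-singleton w))

    #-earlier-miss : ∀ {w κ} → key w ≢ κ → # (earlier? π key κ (suc (slot π w))) ≡ # (earlier? π key κ (slot π w))
    #-earlier-miss {w} {κ} ne = #-cong (earlier? π key κ (suc (slot π w))) (earlier? π key κ (slot π w))
      (λ i (e , lt) → e , ≤∧≢⇒< (s≤s⁻¹ lt) (λ e′ → ne (trans (cong key (sym (slot-injective π e′))) e)))
      (λ i (e , lt) → e , m≤n⇒m≤1+n lt)

    #-earlier-0 : ∀ κ → # (earlier? π key κ 0) ≡ 0
    #-earlier-0 κ = #-∅ (earlier? π key κ 0) λ _ ()

    #-earlier-N : ∀ κ → # (earlier? π key κ N) ≡ # (equal? κ)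
    #-earlier-N κ = #-cong (earlier? π key κ N) (equal? κ) (λ _ → proj₁) (λ i e → e , Fin.toℕ<n (π ⟨$⟩ˡ i))

    #-less-0 : # (less? 0) ≡ 0
    #-less-0 = #-∅ (less? 0) λ _ ()

    #-less-suc : ∀ κ → # (less? (suc (toℕ κ))) ≡ # (less? (toℕ κ)) + # (equal? κ)
    #-less-suc κ = #-split (less? (toℕ κ)) (equal? κ) (less? (suc (toℕ κ)))
      (λ i lt → [ inj₁ , (λ e → inj₂ (Fin.toℕ-injective e)) ]′ (m≤n⇒m<n∨m≡n (s≤s⁻¹ lt)))
      (λ i lt → m≤n⇒m≤1+n lt) (λ { i refl → ≤-refl }) (λ { i lt refl → <-irrefl refl lt })

    place : Fin N → ℕ
    place v = # (less? (toℕ (key v))) + # (earlier? π key (key v) (slot π v))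

    private
      _≺_ : Fin N → Fin N → Set
      u ≺ v = toℕ (key u) < toℕ (key v) ⊎ (key u ≡ key v × slot π u < slot π v)

      _≺?_ : ∀ u v → Dec (u ≺ v)
      u ≺? v = (toℕ (key u) <? toℕ (key v)) ⊎-dec ((key u Fin.≟ key v) ×-dec (slot π u <? slot π v))

      -- `place` is written as the sum of two counters because the program computes it so. As a rank
      -- in the lexicographic order by key and old slot, it is plainly injective and bounded.
      place≡ : ∀ v → place v ≡ # (_≺? v)
      place≡ v = sym (#-split (less? (toℕ (key v))) (earlier? π key (key v) (slot π v)) (_≺? v)
        (λ _ → id) (λ _ → inj₁) (λ _ → inj₂) (λ { i lt (e , _) → <-irrefl (cong toℕ e) lt }))

      ≺-trans : ∀ {u v w} → u ≺ v → v ≺ w → u ≺ w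
      ≺-trans (inj₁ a) (inj₁ b) = inj₁ (<-trans a b)
      ≺-trans (inj₁ a) (inj₂ (e , _)) = inj₁ (<-≤-trans a (≤-reflexive (cong toℕ e)))
      ≺-trans (inj₂ (e , _)) (inj₁ b) = inj₁ (≤-<-trans (≤-reflexive (cong toℕ e)) b)
      ≺-trans (inj₂ (e , a)) (inj₂ (f , b)) = inj₂ (trans e f , <-trans a b)

      ≺-irrefl : ∀ {v} → ¬ (v ≺ v)
      ≺-irrefl (inj₁ lt) = <-irrefl refl lt
      ≺-irrefl (inj₂ (_ , lt)) = <-irrefl refl lt

      ≺-total : ∀ {u v} → u ≢ v → u ≺ v ⊎ v ≺ u
      ≺-total {u} {v} ne with <-cmp (toℕ (key u)) (toℕ (key v))
      ... | tri< lt _ _ = inj₁ (inj₁ lt)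
      ... | tri> _ _ gt = inj₂ (inj₁ gt)
      ... | tri≈ _ e _ with <-cmp (slot π u) (slot π v)
      ... | tri< lt _ _ = inj₁ (inj₂ (Fin.toℕ-injective e , lt))
      ... | tri≈ _ e′ _ = contradiction (slot-injective π e′) ne
      ... | tri> _ _ gt = inj₂ (inj₂ (Fin.toℕ-injective (sym e) , gt))

    place-mono : ∀ {u v} → u ≺ v → place u < place v
    place-mono {u} {v} lt = subst₂ _<_ (sym (place≡ u)) (sym (place≡ v))
      (#-<mono (_≺? u) (_≺? v) (λ i l → ≺-trans l lt) u lt ≺-irrefl)

    place<N : ∀ v → place v < N
    place<N v = subst (_< N) (sym (place≡ v)) (<-≤-trans
      (#-<mono (_≺? v) (λ _ → yes tt) (λ _ _ → tt) v tt ≺-irrefl) (#≤n (λ _ → yes tt)))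

    place-injective : ∀ {u v} → place u ≡ place v → u ≡ v
    place-injective {u} {v} e with u Fin.≟ v
    ... | yes u≡v = u≡v
    ... | no u≢v = [ (λ l → contradiction e (<⇒≢ (place-mono l))) , (λ l → contradiction (sym e) (<⇒≢ (place-mono l))) ]′ (≺-total u≢v)

    #-interval : ∀ a d → # (λ w → (a ≤? slot π w) ×-dec (slot π w <? a + d)) ≤ d
    #-interval a zero = ≤-reflexive (#-∅ (λ w → (a ≤? slot π w) ×-dec (slot π w <? a + 0))
      λ i (le , lt) → <⇒≱ (subst (slot π i <_) (+-identityʳ a) lt) le)
    #-interval a (suc d) = ≤-trans (#-cover
      (λ w → slot π w ≟ a + d) (λ w → (a ≤? slot π w) ×-dec (slot π w <? a + d))
      (λ w → (a ≤? slot π w) ×-dec (slot π w <? a + suc d))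
      λ i (le , lt) → [ (λ l → inj₂ (le , l)) , inj₁ ]′ (m≤n⇒m<n∨m≡n (s≤s⁻¹ (subst (slot π i <_) (+-suc a d) lt))))
      (+-mono-≤ one (#-interval a d))
      where
      one : # (λ w → slot π w ≟ a + d) ≤ 1
      one with Fin.any? (λ w → slot π w ≟ a + d)
      ... | yes (w , e) = ≤-reflexive (#-unique (λ w → slot π w ≟ a + d) w (λ i e′ → slot-injective π (trans e′ (sym e))) e)
      ... | no ¬w = ≤-trans (≤-reflexive (#-∅ (λ w → slot π w ≟ a + d) (λ w e → ¬w (w , e)))) z≤n

    -- Between `v` and a later `u` of equal key only nodes of that key are placed, which yields
    -- `gathers`; by stability these also lay between the two before, which yields `preserves`.
    sorted : Σ[ π′ ∈ Permutation′ N ] ((∀ v → slot π′ v ≡ place v) × Refines key π π′ ×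
             (∀ u v → toℕ (key u) < toℕ (key v) → slot π′ u < slot π′ v))
    sorted with injective⇒permutation (λ v → fromℕ< (place<N v))
                  (λ {u} {v} e → place-injective (Fin.fromℕ<-injective (place u) (place v) _ _ e))
    ... | π′ , eq = π′ , slot≡ , record { gathers = gathers ; preserves = preserves } ,
      λ u v lt → subst₂ _<_ (sym (slot≡ u)) (sym (slot≡ v)) (place-mono (inj₁ lt))
      where
      slot≡ : ∀ v → slot π′ v ≡ place v
      slot≡ v = trans (cong toℕ (eq v)) (Fin.toℕ-fromℕ< (place<N v))

      ≺-same : ∀ {i u v} → key u ≡ key v → i ≺ u → i ≺ v ⊎ (key i ≡ key v × slot π v ≤ slot π i × slot π i < slot π u)
      ≺-same e (inj₁ lt) = inj₁ (inj₁ (<-≤-trans lt (≤-reflexive (cong toℕ e))))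
      ≺-same {i} {u} {v} e (inj₂ (e′ , lt)) with slot π i <? slot π v
      ... | yes l = inj₁ (inj₂ (trans e′ e , l))
      ... | no ¬l = inj₂ (trans e′ e , ≮⇒≥ ¬l , lt)

      gathers : ∀ u v → key u ≡ key v → slot π′ u < slot π′ v + # (equal? (key v))
      gathers u v e = begin-strict
        slot π′ u                        ≡⟨ trans (slot≡ u) (place≡ u) ⟩
        # (_≺? u)
          ≤⟨ #-cover (_≺? v) mid? (_≺? u) (λ i l → [ inj₁ , (λ (a , _ , c) → inj₂ (a , c)) ]′ (≺-same e l)) ⟩
        # (_≺? v) + # mid?
          -- Strict, because `u` belongs to the class but does not precede itself.
          <⟨ +-monoʳ-< (# (_≺? v)) (#-<mono mid? (equal? (key v)) (λ _ → proj₁) u e (λ (_ , l) → <-irrefl refl l)) ⟩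
        # (_≺? v) + # (equal? (key v))   ≡⟨ cong (_+ # (equal? (key v))) (trans (slot≡ v) (place≡ v)) ⟨
        slot π′ v + # (equal? (key v))   ∎
        where
        open ≤-Reasoning
        mid? : Decidable (λ i → key i ≡ key v × slot π i < slot π u)
        mid? i = equal? (key v) i ×-dec (slot π i <? slot π u)

      preserves : ∀ u v → key u ≡ key v → slot π′ u ≤ slot π′ v + (slot π u ∸ slot π v)
      preserves u v e = begin
        slot π′ u                        ≡⟨ trans (slot≡ u) (place≡ u) ⟩
        # (_≺? u)
          ≤⟨ #-cover (_≺? v) mid? (_≺? u) (λ i l → [ inj₁ , (λ (_ , b , c) → inj₂ (b , <-≤-trans c (m≤n+m∸n (slot π u) (slot π v)))) ]′ (≺-same e l)) ⟩
        # (_≺? v) + # mid?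
          ≤⟨ +-monoʳ-≤ (# (_≺? v)) (#-interval (slot π v) (slot π u ∸ slot π v)) ⟩
        # (_≺? v) + (slot π u ∸ slot π v) ≡⟨ cong (_+ (slot π u ∸ slot π v)) (trans (slot≡ v) (place≡ v)) ⟨
        slot π′ v + (slot π u ∸ slot π v) ∎
        where
        open ≤-Reasoning
        mid? : Decidable (λ w → slot π v ≤ slot π w × slot π w < slot π v + (slot π u ∸ slot π v))
        mid? w = (slot π v ≤? slot π w) ×-dec (slot π w <? slot π v + (slot π u ∸ slot π v))

-- The bottom-up pass

module Passes {N : ℕ} (t : Tree N) (b : ℕ) (0<b : 0 < b) where
  open Rooted t
  open Levels t

  private
    par : Fin N → Fin N
    par = parent t

  child? : ∀ w v → Dec (Child t w v)
  child? w v = ¬? (w Fin.≟ root t) ×-dec (par w Fin.≟ v)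

  module _ {P : Pred (Fin N) 0ℓ} (P? : Decidable P) where

    Via : Fin N → Fin N → Set
    Via v u = ∃[ w ] (Child t w v × P w × w ⊒ u)

    via? : ∀ v u → Dec (Via v u)
    via? v u = Fin.any? (λ w → child? w v ×-dec P? w ×-dec w ⊒? u)

    Closed : Set
    Closed = ∀ {v u} → P v → v ⊒ u → P u

    -- The state of the bottom-up pass when the nodes in P are done: at the
    -- other nodes, h and s are the maximal level of a finished child and the
    -- size of the block that would result from joining the children of that level.
    record Partial (h s : Fin N → ℕ) : Set where
      field
        mono    : ∀ {w v} → Child t w v → P w → h w ≤ h v
        small   : ∀ {v} → P v → # (λ u → (v ⊒? u) ×-dec (h u ≟ h v)) ≤ b
        blocked : ∀ {v} → P v → (∃[ w ] (Child t w v × h w ≡ h v)) ⊎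
                  ((∀ w → Child t w v → h w < h v) ×
                   (∀ k → h v ≡ suc k → b ≤ # (λ u → (v ⊐? u) ×-dec (h u ≟ k))))
        maximum : ∀ {v} → ¬ P v → (∃[ w ] (Child t w v × P w × h w ≡ h v)) ⊎
                  ((∀ w → Child t w v → ¬ P w) × h v ≡ 0)
        joined  : ∀ {v} → ¬ P v → s v ≡ suc (# (λ u → via? v u ×-dec (h u ≟ h v)))

  -- `k` and `n` are level and block size of the node just finished, `h` and `s` those recorded at
  -- its parent, and the two indices the parent's record afterwards. The constructors match the
  -- branches of the program.
  data Push (k n h s : ℕ) : ℕ → ℕ → Set where
    above : h < k → Push k n h s k (suc n)
    level : h ≡ k → Push k n h s h (s + n)
    below : k < h → Push k n h s h s

  push-≥ : ∀ {k n h s h′ s′} → Push k n h s h′ s′ → k ≤ h′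
  push-≥ (above _) = ≤-refl
  push-≥ (level e) = ≤-reflexive (sym e)
  push-≥ (below l) = <⇒≤ l

  push-≤ : ∀ {k n h s h′ s′} → Push k n h s h′ s′ → h ≤ h′
  push-≤ (above l) = <⇒≤ l
  push-≤ (level _) = ≤-refl
  push-≤ (below _) = ≤-refl

  data Close (h s : ℕ) : ℕ → ℕ → Set where
    full : b < s → Close h s (suc h) 1
    room : s ≤ b → Close h s h s

  -- The finished sets are kept abstract, closed under descendants and differing in `v` alone; on
  -- the machine they are final segments of the depth order. The new levels `h₂` are known only
  -- through their values, so that every branch of the program fits.
  module Step {P : Pred (Fin N) 0ℓ} (P? : Decidable P) {P′ : Pred (Fin N) 0ℓ} (P′? : Decidable P′) {v : Fin N}
    (old : ∀ {u} → P u → P′ u) (now : P′ v) (only : ∀ {u} → P′ u → P u ⊎ u ≡ v) (v∉ : ¬ P v)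
    (closed : Closed P?) (closed′ : Closed P′?)
    {h s : Fin N → ℕ} (S : Partial P? h s)
    {h₂ : Fin N → ℕ} (h₂old : ∀ {u} → P u → h₂ u ≡ h u) where

    open Partial S

    below∈P : ∀ {u} → v ⊐ u → P u
    below∈P v⊐u with only (closed′ now (proj₁ v⊐u))
    ... | inj₁ p = p
    ... | inj₂ refl = contradiction (proj₂ v⊐u) (<-irrefl refl)

    child∈P : ∀ {w} → Child t w v → P w
    child∈P c = below∈P (child⊐ c)

    mono⊒ : ∀ {w u} → P w → w ⊒ u → h u ≤ h w
    mono⊒ {w} {u} Pw w⊒u = go (depth u) u refl w⊒u
      where
      go : ∀ d u → depth u ≡ d → w ⊒ u → h u ≤ h w
      go d u e w⊒u with ⊒⇒≡⊎⊐ w⊒u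
      ... | inj₁ refl = ≤-refl
      go zero u e w⊒u | inj₂ (_ , lt) = contradiction (subst (depth w <_) e lt) λ ()
      go (suc d) u e w⊒u | inj₂ w⊐u@(_ , lt) = ≤-trans
        (mono (u≢r , refl) (closed Pw w⊒u)) (go d (par u) (suc-injective (trans (sym (depth-suc u≢r)) e)) (⊐-parent w⊐u))
        where
        u≢r : u ≢ root t
        u≢r = depth>0⇒≢root (≤-<-trans z≤n lt)

    via⇒≤ : ∀ {x u} → Via P? x u → h u ≤ h x
    via⇒≤ (w , c , Pw , w⊒u) = ≤-trans (mono⊒ Pw w⊒u) (mono c Pw)

    via⇒P : ∀ {x u} → Via P? x u → P u
    via⇒P (w , c , Pw , w⊒u) = closed Pw w⊒u

    ⊐⇒via : ∀ {u} → v ⊐ u → Via P? v u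
    ⊐⇒via v⊐u with ⊐-child v⊐u
    ... | w , c , w⊒u = w , c , child∈P c , w⊒u

    via⇒⊐ : ∀ {x u} → Via P? x u → x ⊐ u
    via⇒⊐ (w , c , Pw , w⊒u) = ⊐-⊒-trans (child⊐ c) w⊒u

    #-below : ∀ k → # (λ u → (v ⊐? u) ×-dec (h₂ u ≟ k)) ≡ # (λ u → via? P? v u ×-dec (h u ≟ k))
    #-below k = #-cong (λ u → (v ⊐? u) ×-dec (h₂ u ≟ k)) (λ u → via? P? v u ×-dec (h u ≟ k))
      (λ u (a , e) → ⊐⇒via a , trans (sym (h₂old (below∈P a))) e)
      (λ u (a , e) → via⇒⊐ a , trans (h₂old (via⇒P a)) e)

    #-here : ∀ {k} → h₂ v ≡ k → # (λ u → (v ⊒? u) ×-dec (h₂ u ≟ k)) ≡ suc (# (λ u → (v ⊐? u) ×-dec (h₂ u ≟ k)))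
    #-here {k} h₂v = trans (#-split (Fin._≟ v) (λ u → (v ⊐? u) ×-dec (h₂ u ≟ k)) (λ u → (v ⊒? u) ×-dec (h₂ u ≟ k))
      (λ u (a , e) → [ inj₁ , (λ a′ → inj₂ (a′ , e)) ]′ (⊒⇒≡⊎⊐ a))
      (λ { u refl → ⊒-refl , h₂v }) (λ u (a , e) → proj₁ a , e)
      (λ { u refl ((_ , lt) , _) → <-irrefl refl lt }))
      (cong (_+ # (λ u → (v ⊐? u) ×-dec (h₂ u ≟ k))) (#-singleton v))

    close-size : ∀ {k n} → Close (h v) (s v) k n → h₂ v ≡ k →
                 # (λ u → (v ⊒? u) ×-dec (h₂ u ≟ k)) ≡ n × n ≤ b
    close-size (full _) h₂v = trans (#-here h₂v) (cong suc (trans (#-below (suc (h v)))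
      (#-∅ (λ u → via? P? v u ×-dec (h u ≟ suc (h v))) λ u (a , e) → <-irrefl e (s≤s (via⇒≤ a))))) , 0<b
    close-size (room le) h₂v = trans (#-here h₂v) (trans (cong suc (#-below (h v))) (sym (joined v∉))) , le

    close-≤ : ∀ {k n} → Close (h v) (s v) k n → h v ≤ k
    close-≤ (full _) = n≤1+n _
    close-≤ (room _) = ≤-refl

    close-blocked : ∀ {k n} → Close (h v) (s v) k n → h₂ v ≡ k → (∃[ w ] (Child t w v × h₂ w ≡ h₂ v)) ⊎
                  ((∀ w → Child t w v → h₂ w < h₂ v) ×
                   (∀ j → h₂ v ≡ suc j → b ≤ # (λ u → (v ⊐? u) ×-dec (h₂ u ≟ j))))
    close-blocked (full b<s) h₂v = inj₂ ((λ w c → subst₂ _<_ (sym (h₂old (child∈P c))) (sym h₂v) (s≤s (mono c (child∈P c)))) ,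
      -- `s v` counts `v` itself, so `b < s v` leaves at least `b` nodes of level `h v` strictly
      -- below `v`.
      λ j e → subst (λ j → b ≤ # (λ u → (v ⊐? u) ×-dec (h₂ u ≟ j))) (suc-injective (trans (sym h₂v) e))
        (subst (b ≤_) (sym (#-below (h v))) (s≤s⁻¹ (subst (b <_) (joined v∉) b<s))))
    close-blocked (room _) h₂v with maximum v∉
    ...   | inj₁ (w , c , Pw , e) = inj₁ (w , c , trans (h₂old Pw) (trans e (sym h₂v)))
    ...   | inj₂ (none , h0) = inj₂ ((λ w c → contradiction (child∈P c) (none w c)) ,
      λ j e → contradiction (trans (sym h0) (trans (sym h₂v) e)) 0≢1+n)

    module _ {k n} (C : Close (h v) (s v) k n) (h₂v : h₂ v ≡ k) where

      size : # (λ u → (v ⊒? u) ×-dec (h₂ u ≟ k)) ≡ n × n ≤ b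
      size = close-size C h₂v

      h≤k : h v ≤ k
      h≤k = close-≤ C

      child≤k : ∀ {w} → Child t w v → h w ≤ k
      child≤k c = ≤-trans (mono c (child∈P c)) h≤k

      small-done : ∀ {x} → P′ x → # (λ u → (x ⊒? u) ×-dec (h₂ u ≟ h₂ x)) ≤ b
      small-done {x} P′x with only P′x
      ... | inj₁ Px = ≤-trans (#-mono (λ u → (x ⊒? u) ×-dec (h₂ u ≟ h₂ x)) (λ u → (x ⊒? u) ×-dec (h u ≟ h x))
        (λ u (a , e) → a , trans (sym (h₂old (closed Px a))) (trans e (h₂old Px)))) (small Px)
      ... | inj₂ refl = subst (λ k → # (λ u → (v ⊒? u) ×-dec (h₂ u ≟ k)) ≤ b) (sym h₂v)
        (≤-trans (≤-reflexive (proj₁ size)) (proj₂ size))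

      blocked-done : ∀ {x} → P′ x → (∃[ w ] (Child t w x × h₂ w ≡ h₂ x)) ⊎
                    ((∀ w → Child t w x → h₂ w < h₂ x) ×
                     (∀ j → h₂ x ≡ suc j → b ≤ # (λ u → (x ⊐? u) ×-dec (h₂ u ≟ j))))
      blocked-done {x} P′x with only P′x
      ... | inj₂ refl = close-blocked C h₂v
      ... | inj₁ Px with blocked Px
      ...   | inj₁ (w , c , e) = inj₁ (w , c , trans (h₂old (closed Px (proj₁ (child⊐ c)))) (trans e (sym (h₂old Px))))
      ...   | inj₂ (lt , many) = inj₂ ((λ w c → subst₂ _<_ (sym (h₂old (closed Px (proj₁ (child⊐ c))))) (sym (h₂old Px)) (lt w c)) ,
        λ j e → ≤-trans (many j (trans (sym (h₂old Px)) e))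
          (#-mono (λ u → (x ⊐? u) ×-dec (h u ≟ j)) (λ u → (x ⊐? u) ×-dec (h₂ u ≟ j))
            λ u (a , e′) → a , trans (h₂old (closed Px (proj₁ a))) e′))

      -- The root is its own parent, so pushing adds its block size to itself; this is why `s₂` is
      -- arbitrary. Once the root is finished all nodes are, and nothing is claimed about sizes any
      -- more.
      at-root : v ≡ root t → ∀ {s₂} → Partial P′? h₂ s₂
      at-root refl = record
        { mono = mono′
        ; small = small-done ; blocked = blocked-done
        ; maximum = λ x∉ → contradiction all x∉
        ; joined = λ x∉ → contradiction all x∉ }
        where
        all : ∀ {x} → P′ x
        all {x} = closed′ now (root⊒ x)
        mono′ : ∀ {w x} → Child t w x → P′ w → h₂ w ≤ h₂ x
        mono′ {w} {x} c P′w with only P′w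
        ... | inj₂ refl = contradiction refl (proj₁ c)
        ... | inj₁ Pw with only (all {x})
        ...   | inj₁ Px = subst₂ _≤_ (sym (h₂old Pw)) (sym (h₂old Px)) (mono c Pw)
        ...   | inj₂ refl = subst₂ _≤_ (sym (h₂old Pw)) (sym h₂v) (child≤k c)

      below-root : v ≢ root t → ∀ {s₂ hₚ sₚ} → Push k n (h (par v)) (s (par v)) hₚ sₚ →
        h₂ (par v) ≡ hₚ → s₂ (par v) ≡ sₚ →
        (∀ {u} → ¬ P′ u → u ≢ par v → h₂ u ≡ h u × s₂ u ≡ s u) → Partial P′? h₂ s₂
      below-root v≢r {s₂} {hₚ} {sₚ} push h₂p s₂p same = record
        { mono = mono′ ; small = small-done ; blocked = blocked-done
        ; maximum = maximum′ ; joined = joined′ }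
        where
        p = par v
        cv : Child t v p
        cv = v≢r , refl
        k≤hp : k ≤ hₚ
        k≤hp = push-≥ push
        hp≤ : h p ≤ hₚ
        hp≤ = push-≤ push

        mono′ : ∀ {w x} → Child t w x → P′ w → h₂ w ≤ h₂ x
        mono′ {w} {x} c P′w with only P′w
        mono′ (_ , refl) P′w | inj₂ refl = subst₂ _≤_ (sym h₂v) (sym h₂p) k≤hp
        mono′ {w} {x} c P′w | inj₁ Pw with P′? x
        ... | yes P′x with only P′x
        ...   | inj₁ Px = subst₂ _≤_ (sym (h₂old Pw)) (sym (h₂old Px)) (mono c Pw)
        ...   | inj₂ refl = subst₂ _≤_ (sym (h₂old Pw)) (sym h₂v) (child≤k c)
        mono′ {w} {x} c P′w | inj₁ Pw | no ¬P′x with x Fin.≟ p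
        ... | yes refl = subst₂ _≤_ (sym (h₂old Pw)) (sym h₂p) (≤-trans (mono c Pw) hp≤)
        ... | no x≢p = subst₂ _≤_ (sym (h₂old Pw)) (sym (proj₁ (same ¬P′x x≢p))) (mono c Pw)

        child-old : ∀ {w x} → x ≢ p → Child t w x → P′ w → P w
        child-old x≢p c P′w with only P′w
        ... | inj₁ Pw = Pw
        child-old x≢p (_ , refl) P′w | inj₂ refl = contradiction refl x≢p

        maximum′ : ∀ {x} → ¬ P′ x → (∃[ w ] (Child t w x × P′ w × h₂ w ≡ h₂ x)) ⊎
                    ((∀ w → Child t w x → ¬ P′ w) × h₂ x ≡ 0)
        maximum′ {x} x∉ with x Fin.≟ p
        ... | no x≢p with maximum (λ Px → x∉ (old Px))
        ...   | inj₁ (w , c , Pw , e) = inj₁ (w , c , old Pw , trans (h₂old Pw) (trans e (sym (proj₁ (same x∉ x≢p)))))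
        ...   | inj₂ (none , h0) = inj₂ ((λ w c P′w → none w c (child-old x≢p c P′w)) , trans (proj₁ (same x∉ x≢p)) h0)
        maximum′ {x} x∉ | yes refl = at-p push h₂p
          where
          at-p : ∀ {h′ s′} → Push k n (h p) (s p) h′ s′ → h₂ p ≡ h′ →
            (∃[ w ] (Child t w p × P′ w × h₂ w ≡ h₂ p)) ⊎ ((∀ w → Child t w p → ¬ P′ w) × h₂ p ≡ 0)
          at-p (above _) h₂p = inj₁ (v , cv , now , trans h₂v (sym h₂p))
          at-p (level e) h₂p = inj₁ (v , cv , now , trans h₂v (trans (sym e) (sym h₂p)))
          at-p (below l) h₂p with maximum (λ Px → x∉ (old Px))
          ... | inj₁ (w , c , Pw , e) = inj₁ (w , c , old Pw , trans (h₂old Pw) (trans e (sym h₂p)))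
          ... | inj₂ (_ , h0) = contradiction (subst (k <_) h0 l) λ ()

        via-old : ∀ {x u} → Via P? x u → Via P′? x u
        via-old (w , c , Pw , a) = w , c , old Pw , a

        -- Siblings have disjoint subtrees: two ancestors of `u` at the same depth coincide.
        old-only : ∀ {u} → Via P? p u → ¬ (v ⊒ u)
        old-only (w , c , Pw , a) b = v∉ (subst P (⊒-unique a b (trans (child-depth c) (sym (depth-suc v≢r)))) Pw)

        via-new : ∀ {u} → Via P′? p u → Via P? p u ⊎ v ⊒ u
        via-new (w , c , P′w , a) with only P′w
        ... | inj₁ Pw = inj₁ (w , c , Pw , a)
        ... | inj₂ refl = inj₂ a

        v⊒⇒≤ : ∀ {u} → v ⊒ u → h₂ u ≤ k
        v⊒⇒≤ a with ⊒⇒≡⊎⊐ a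
        ... | inj₁ refl = ≤-reflexive h₂v
        ... | inj₂ a′ = ≤-trans (≤-reflexive (h₂old (below∈P a′))) (≤-trans (via⇒≤ (⊐⇒via a′)) h≤k)

        joined′ : ∀ {x} → ¬ P′ x → s₂ x ≡ suc (# (λ u → via? P′? x u ×-dec (h₂ u ≟ h₂ x)))
        joined′ {x} x∉ with x Fin.≟ p
        ... | no x≢p = trans (proj₂ (same x∉ x≢p)) (trans (joined (λ Px → x∉ (old Px))) (cong suc
          (#-cong (λ u → via? P? x u ×-dec (h u ≟ h x)) (λ u → via? P′? x u ×-dec (h₂ u ≟ h₂ x))
            (λ u (a , e) → via-old a , trans (h₂old (via⇒P a)) (trans e (sym (proj₁ (same x∉ x≢p)))))
            (λ { u ((w , c , P′w , a) , e) → let Pw = child-old x≢p c P′w in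
              (w , c , Pw , a) , trans (sym (h₂old (closed Pw a))) (trans e (proj₁ (same x∉ x≢p))) }))))
        ... | yes refl = trans s₂p (subst (λ k → sₚ ≡ suc (# (λ u → via? P′? p u ×-dec (h₂ u ≟ k)))) (sym h₂p) (go push))
          where
          go : ∀ {h′ s′} → Push k n (h p) (s p) h′ s′ → s′ ≡ suc (# (λ u → via? P′? p u ×-dec (h₂ u ≟ h′)))
          -- Nodes under earlier children have levels at most `h p < k`, so on level `k` there is
          -- only the block of `v`, to which the parent adds itself.
          go (above l) = cong suc (trans (sym (proj₁ size)) (#-cong
            (λ u → (v ⊒? u) ×-dec (h₂ u ≟ k)) (λ u → via? P′? p u ×-dec (h₂ u ≟ k))
            (λ u (a , e) → (v , cv , now , a) , e)
            (λ u (a , e) → [ (λ a′ → contradiction (subst (_≤ h p) (trans (sym (h₂old (via⇒P a′))) e) (via⇒≤ a′)) (<⇒≱ l)) , (λ a′ → a′ , e) ]′ (via-new a))))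
          go (level e₀) = trans (cong (_+ n) (joined (λ Px → x∉ (old Px)))) (cong suc
            (trans (cong (# (λ u → via? P? p u ×-dec (h u ≟ h p)) +_) (sym (proj₁ size))) (sym (#-split
            (λ u → via? P? p u ×-dec (h u ≟ h p)) (λ u → (v ⊒? u) ×-dec (h₂ u ≟ k)) (λ u → via? P′? p u ×-dec (h₂ u ≟ h p))
            (λ u (a , e) → [ (λ a′ → inj₁ (a′ , trans (sym (h₂old (via⇒P a′))) e)) , (λ a′ → inj₂ (a′ , trans e e₀)) ]′ (via-new a))
            (λ u (a , e) → via-old a , trans (h₂old (via⇒P a)) e)
            (λ u (a , e) → (v , cv , now , a) , trans e (sym e₀))
            (λ u (a , _) (a′ , _) → old-only a a′)))))
          go (below l) = trans (joined (λ Px → x∉ (old Px))) (cong suc (#-cong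
            (λ u → via? P? p u ×-dec (h u ≟ h p)) (λ u → via? P′? p u ×-dec (h₂ u ≟ h p))
            (λ u (a , e) → via-old a , trans (h₂old (via⇒P a)) e)
            (λ u (a , e) → [ (λ a′ → a′ , trans (sym (h₂old (via⇒P a′))) e) , (λ a′ → contradiction (subst (_≤ k) e (v⊒⇒≤ a′)) (<⇒≱ l)) ]′ (via-new a))))

  partial-start : ∀ {P : Pred (Fin N) 0ℓ} (P? : Decidable P) → (∀ v → ¬ P v) → Partial P? (λ _ → 0) (λ _ → 1)
  partial-start P? none = record
    { mono = λ _ _ → z≤n
    ; small = λ {v} p → contradiction p (none v)
    ; blocked = λ {v} p → contradiction p (none v)
    ; maximum = λ _ → inj₂ ((λ w _ → none w) , refl)
    ; joined = λ {v} _ → cong suc (sym (#-∅ (λ u → via? P? v u ×-dec (0 ≟ 0)) λ { u ((w , _ , p , _) , _) → none w p }))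
    }

  partial-end : ∀ {P : Pred (Fin N) 0ℓ} (P? : Decidable P) → (∀ v → P v) → ∀ {h s} → Partial P? h s → Greedy b h
  partial-end P? all {h} S = record
    { monotone = mono′ ; small = λ v → small (all v) ; blocked = λ v → blocked (all v) }
    where
    open Partial S
    mono′ : ∀ v → h v ≤ h (par v)
    mono′ v with v Fin.≟ root t
    ... | yes refl = ≤-reflexive (cong h (sym (root-parent t)))
    ... | no v≢r = mono (v≢r , refl) (all v)

-- Program logic

module Machine (A : BlackBox) where

  Run : Program → (State → Set) → ℕ → State → Set
  Run p Q k σ = ∃[ σ′ ] ∃[ τ ] (Exec A p σ σ′ τ × Q σ′ × τ ≤ k)

  -- Programs with loops or calls get ⊥; they are covered by rules of their own.
  wp : Program → (State → Set) → State → Set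
  wp skip Q σ = Q σ
  wp (x ≔ e) Q σ = Q (setReg σ x (eval σ e))
  wp (a [ d ]≔ e) Q σ = Q (setArray σ a (update (mem σ a) (eval σ d) (eval σ e)))
  wp (p ⨾ q) Q σ = wp p (wp q Q) σ
  wp (cond e p q) Q σ = (eval σ e ≢ 0 → wp p Q σ) × (eval σ e ≡ 0 → wp q Q σ)
  wp (while _ _) Q σ = ⊥
  wp (callLayout _ _ _ _) Q σ = ⊥

  wp-mono : ∀ p {Q R : State → Set} {σ} → (∀ σ → Q σ → R σ) → wp p Q σ → wp p R σ
  wp-mono skip f w = f _ w
  wp-mono (x ≔ e) f w = f _ w
  wp-mono (a [ d ]≔ e) f w = f _ w
  wp-mono (p ⨾ q) f w = wp-mono p (λ _ → wp-mono q f) w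
  wp-mono (cond e p q) f (w , w′) = (λ ne → wp-mono p f (w ne)) , (λ eq → wp-mono q f (w′ eq))

-- A step bound for programs without loops and calls. Adding both branches of a conditional bounds
-- either of them and keeps the bound independent of the state.
cost : Program → ℕ
cost (p ⨾ q) = cost p + cost q
cost (cond _ p q) = suc (cost p + cost q)
cost _ = 1

module _ {A : BlackBox} where
  open Machine A

  wp-sound : ∀ p {Q σ} → wp p Q σ → Run p Q (cost p) σ
  wp-sound skip w = _ , _ , skip , w , ≤-refl
  wp-sound (x ≔ e) w = _ , _ , assign , w , ≤-refl
  wp-sound (a [ d ]≔ e) w = _ , _ , store , w , ≤-refl
  wp-sound (p ⨾ q) w with wp-sound p w
  ... | σ₁ , τ₁ , ex₁ , w₁ , le₁ with wp-sound q w₁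
  ... | σ₂ , τ₂ , ex₂ , w₂ , le₂ = σ₂ , _ , seq ex₁ ex₂ , w₂ , +-mono-≤ le₁ le₂
  wp-sound (cond e p q) {σ = σ} (w , w′) with eval σ e ≟ 0
  ... | yes eq with wp-sound q (w′ eq)
  ...   | σ₁ , τ₁ , ex , w₁ , le = σ₁ , _ , if-false eq ex , w₁ , s≤s (≤-trans le (m≤n+m _ (cost p)))
  wp-sound (cond e p q) (w , w′) | no ne with wp-sound p (w ne)
  ...   | σ₁ , τ₁ , ex , w₁ , le = σ₁ , _ , if-true ne ex , w₁ , s≤s (≤-trans le (m≤m+n (cost p) _))

  run-weaken : ∀ {p Q R k l σ} → (∀ σ → Q σ → R σ) → k ≤ l → Run p Q k σ → Run p R l σ
  run-weaken f le (σ , τ , ex , q , le′) = σ , τ , ex , f σ q , ≤-trans le′ le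

  run-seq : ∀ {p q Q R k l σ} → Run p Q k σ → (∀ σ → Q σ → Run q R l σ) → Run (p ⨾ q) R (k + l) σ
  run-seq (σ₁ , τ₁ , ex₁ , q₁ , le₁) f with f σ₁ q₁
  ... | σ₂ , τ₂ , ex₂ , q₂ , le₂ = σ₂ , _ , seq ex₁ ex₂ , q₂ , +-mono-≤ le₁ le₂

  run-cond : ∀ {e p q Q k σ} → (eval σ e ≢ 0 → Run p Q k σ) → (eval σ e ≡ 0 → Run q Q k σ) →
             Run (cond e p q) Q (suc k) σ
  run-cond {e} {σ = σ} f g with eval σ e ≟ 0
  ... | yes eq with g eq
  ...   | σ₁ , τ , ex , q , le = σ₁ , _ , if-false eq ex , q , s≤s le
  run-cond f g | no ne with f ne
  ...   | σ₁ , τ , ex , q , le = σ₁ , _ , if-true ne ex , q , s≤s le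

  -- Multiples of `suc N` absorb constant overhead even for small `N`, and the coefficients of
  -- consecutive programs simply add.
  record Linear (N : ℕ) (p : Program) (Q : State → Set) (c : ℕ) (σ : State) : Set where
    constructor linear
    field run : Run p Q (c * suc N) σ

  linear-seq : ∀ {N p q Q R} c {d σ} → Linear N p Q c σ → (∀ σ → Q σ → Linear N q R d σ) →
               Linear N (p ⨾ q) R (c + d) σ
  linear-seq {N} c {d} (linear r) f = linear
    (run-weaken (λ _ → id) (≤-reflexive (sym (*-distribʳ-+ (suc N) c d))) (run-seq r λ σ q → Linear.run (f σ q)))

  linear-const : ∀ {N p Q c σ} → Run p Q c σ → Linear N p Q c σ
  linear-const {N} {c = c} r = linear
    (run-weaken (λ _ → id) (≤-trans (≤-reflexive (sym (*-identityʳ c))) (*-monoʳ-≤ c (s≤s z≤n))) r)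

  linear-weaken : ∀ {N p Q R c d σ} → (∀ σ → Q σ → R σ) → c ≤ d → Linear N p Q c σ → Linear N p R d σ
  linear-weaken {N} f le (linear r) = linear (run-weaken f (*-monoˡ-≤ (suc N) le) r)

for : Program → Program
for p = 1 ≔ lit 0 ⨾ while (reg 0 ⊖ reg 1) (p ⨾ 1 ≔ reg 1 ⊕ lit 1)

-- A round takes at most `cost p + 2` steps with its test and increment; the extra round in `suc N`
-- and the larger coefficient cover the initial assignment and the last test.
forTime : Program → ℕ
forTime p = cost p + 4

-- The test is nonzero exactly while register 2 holds at most `N`.
doubling : Program → Program
doubling p = 2 ≔ lit 1 ⨾ while (reg 0 ⊕ lit 1 ⊖ reg 2) (p ⨾ 2 ≔ reg 2 ⊕ reg 2)

module _ {A : BlackBox} where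
  open Machine A

  -- The invariant is demanded with register 1 already incremented. The invariants in use speak of
  -- other registers and of arrays, so they pass through this assignment by computation.
  for-rule : ∀ {N} p (I : ℕ → State → Set) → (∀ {i σ} → I i σ → regs σ 0 ≡ N) →
    (∀ (i : Fin N) σ → regs σ 1 ≡ toℕ i → I (toℕ i) σ →
      wp p (λ σ′ → regs σ′ 1 ≡ toℕ i × I (suc (toℕ i)) (setReg σ′ 1 (suc (toℕ i)))) σ) →
    ∀ σ → I 0 (setReg σ 1 0) → Linear {A} N (for p) (I N) (forTime p) σ
  for-rule {N} p I size step σ I₀ =
    linear (run-weaken (λ _ → id) total (run-seq {Q = λ σ → regs σ 1 ≡ 0 × I 0 σ} (_ , _ , assign , (refl , I₀) , ≤-refl) (λ σ (e , Iσ) → loop N 0 σ refl e Iσ)))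
    where
    loop : ∀ d i σ → i + d ≡ N → regs σ 1 ≡ i → I i σ →
           Run (while (reg 0 ⊖ reg 1) (p ⨾ 1 ≔ reg 1 ⊕ lit 1)) (I N) (suc (d * (cost p + 2))) σ
    loop zero i σ e r Iσ = σ , 1 ,
      while-false (trans (cong₂ _∸_ (size Iσ) r) (trans (cong (N ∸_) i≡N) (n∸n≡0 N))) ,
      subst (λ i → I i σ) i≡N Iσ , ≤-refl
      where
      i≡N = trans (sym (+-identityʳ i)) e
    loop (suc d) i σ e r Iσ = again
      where
      i<N : i < N
      i<N = subst (i <_) e (m<m+n i z<s)
      j = fromℕ< i<N
      j≡i : toℕ j ≡ i
      j≡i = Fin.toℕ-fromℕ< i<N
      again : Run (while (reg 0 ⊖ reg 1) (p ⨾ 1 ≔ reg 1 ⊕ lit 1)) (I N) (suc (suc d * (cost p + 2))) σ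
      again with wp-sound {A} p (step j σ (trans r (sym j≡i)) (subst (λ i → I i σ) (sym j≡i) Iσ))
      ... | σ₁ , τ₁ , ex₁ , (r₁ , I₁) , le₁
        with loop d (suc i) (setReg σ₁ 1 (regs σ₁ 1 + 1)) (trans (sym (+-suc i d)) e)
               (trans (cong (_+ 1) (trans r₁ j≡i)) (+-comm i 1))
               (subst₂ I (cong suc j≡i) (cong (setReg σ₁ 1) (trans (+-comm 1 (toℕ j)) (cong (_+ 1) (sym r₁)))) I₁)
      ... | σ₂ , τ₂ , ex₂ , I₂ , le₂ = σ₂ , _ ,
        while-true (λ z → <⇒≱ i<N (m∸n≡0⇒m≤n (trans (sym (cong₂ _∸_ (size Iσ) r)) z))) (seq ex₁ assign) ex₂ , I₂ ,
        s≤s (≤-trans (+-mono-≤ (+-monoˡ-≤ 1 le₁) le₂)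
          (≤-reflexive (trans (+-suc (cost p + 1) (d * (cost p + 2)))
            (cong (_+ d * (cost p + 2)) (trans (sym (+-suc (cost p) 1)) refl)))))
    total : 1 + suc (N * (cost p + 2)) ≤ (cost p + 4) * suc N
    total = begin
      2 + N * (cost p + 2)
        ≤⟨ +-mono-≤ (m≤n+m 2 (cost p)) (*-monoʳ-≤ N (+-monoʳ-≤ (cost p) (s≤s (s≤s z≤n)))) ⟩
      cost p + 2 + N * (cost p + 4)
        ≤⟨ +-monoˡ-≤ (N * (cost p + 4)) (+-monoʳ-≤ (cost p) (s≤s (s≤s z≤n))) ⟩
      suc N * (cost p + 4)                    ≡⟨ *-comm (suc N) (cost p + 4) ⟩
      (cost p + 4) * suc N                    ∎
      where open ≤-Reasoning

  -- The inner loop maintains `N < b * 2 ^ f` with `f` rounds left: doubling `b` uses up one factor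
  -- 2, and with no factor left the test must fail.
  doubling-rule : ∀ {N} p (I : ℕ → State → Set) k → (∀ {b σ} → I b σ → regs σ 0 ≡ N × regs σ 2 ≡ b) →
    (∀ b σ → 0 < b → I b σ →
      Run p (λ σ′ → regs σ′ 2 ≡ b × I (b + b) (setReg σ′ 2 (b + b))) k σ) →
    ∀ σ → I 1 (setReg σ 2 1) → ∀ f → N < 2 ^ f →
    Run (doubling p) (λ σ → ∃[ b ] (N < b × I b σ)) (2 + f * (k + 2)) σ
  doubling-rule {N} p I k size step σ I₁ f N<2^f =
    run-seq {Q = I 1} (_ , _ , assign , I₁ , ≤-refl) (λ σ Iσ → loop f 1 σ (s≤s z≤n) (subst (N <_) (sym (+-identityʳ (2 ^ f))) N<2^f) Iσ)
    where
    loop : ∀ f b σ → 0 < b → N < b * 2 ^ f → I b σ →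
           Run (while (reg 0 ⊕ lit 1 ⊖ reg 2) (p ⨾ 2 ≔ reg 2 ⊕ reg 2)) (λ σ → ∃[ b ] (N < b × I b σ)) (suc (f * (k + 2))) σ
    loop f b σ 0<b lt Iσ with b ≤? N
    ... | no b≰N = σ , 1 , while-false (trans (cong₂ (λ n b → n + 1 ∸ b) (proj₁ (size Iσ)) (proj₂ (size Iσ)))
      (m≤n⇒m∸n≡0 (subst (_≤ b) (+-comm 1 N) (≰⇒> b≰N)))) , (b , ≰⇒> b≰N , Iσ) , s≤s z≤n
    loop zero b σ 0<b lt Iσ | yes b≤N = contradiction (subst (N <_) (*-identityʳ b) lt) (≤⇒≯ b≤N)
    loop (suc f) b σ 0<b lt Iσ | yes b≤N with step b σ 0<b Iσ
    ... | σ₁ , τ₁ , ex₁ , (r₁ , I₁) , le₁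
      with loop f (b + b) (setReg σ₁ 2 (regs σ₁ 2 + regs σ₁ 2)) (≤-trans 0<b (m≤m+n b b))
             (subst (N <_) (trans (cong (λ z → b * (2 ^ f + z)) (+-identityʳ (2 ^ f)))
               (trans (*-distribˡ-+ b (2 ^ f) (2 ^ f)) (sym (*-distribʳ-+ (2 ^ f) b b)))) lt)
             (subst (λ r → I (b + b) (setReg σ₁ 2 (r + r))) (sym r₁) I₁)
    ... | σ₂ , τ₂ , ex₂ , I₂ , le₂ = σ₂ , _ ,
      while-true (λ z → <⇒≱ (subst (b <_) (+-comm 1 N) (s≤s b≤N)) (m∸n≡0⇒m≤n (trans (sym (cong₂ (λ n b → n + 1 ∸ b) (proj₁ (size Iσ)) (proj₂ (size Iσ)))) z)))
        (seq ex₁ assign) ex₂ , I₂ ,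
      s≤s (≤-trans (+-mono-≤ (+-monoˡ-≤ 1 le₁) le₂)
          (≤-reflexive (trans (+-suc (k + 1) (f * (k + 2)))
            (cong (_+ f * (k + 2)) (sym (+-suc k 1))))))

-- Array contents as functions on the nodes

update-hit : ∀ {A : Set} (f : ℕ → A) {i j} x → i ≡ j → update f i x j ≡ x
update-hit f {i} {j} x e = cong (λ c → if c then x else f j) (dec-true (i ≟ j) e)

update-miss : ∀ {A : Set} (f : ℕ → A) {i j} x → i ≢ j → update f i x j ≡ f j
update-miss f {i} {j} x ne = cong (λ c → if c then x else f j) (dec-false (i ≟ j) ne)

module Arrays {N : ℕ} where

  infix 4 _≗ᶠ_

  record _≗ᶠ_ (f : ℕ → ℕ) (g : Fin N → ℕ) : Set where
    constructor pointwise
    field at : ∀ u → f (toℕ u) ≡ g u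

  record Filled (i : ℕ) (f : ℕ → ℕ) (g : Fin N → ℕ) : Set where
    constructor filled
    field filled-at : ∀ u → toℕ u < i → f (toℕ u) ≡ g u

  open _≗ᶠ_ public
  open Filled public

  filled-0 : ∀ {f g} → Filled 0 f g
  filled-0 = filled λ u ()

  filled-N : ∀ {f g} → Filled N f g → f ≗ᶠ g
  filled-N (filled F) = pointwise λ u → F u (Fin.toℕ<n u)

  filled-suc : ∀ {f g} (i : Fin N) {j x} → Filled (toℕ i) f g → j ≡ toℕ i → x ≡ g i →
               Filled (suc (toℕ i)) (update f j x) g
  filled-suc {f} {g} i {x = x} (filled F) refl e = filled go
    where
    go : ∀ u → toℕ u < suc (toℕ i) → update f (toℕ i) x (toℕ u) ≡ g u
    go u lt with m≤n⇒m<n∨m≡n (s≤s⁻¹ lt)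
    ... | inj₁ l = trans (update-miss f _ (λ e → <⇒≢ l (sym e))) (F u l)
    ... | inj₂ e′ with Fin.toℕ-injective e′
    ...   | refl = trans (update-hit f _ refl) e

  put : (Fin N → ℕ) → Fin N → ℕ → Fin N → ℕ
  put g v x u = if does (v Fin.≟ u) then x else g u

  put-hit : ∀ g v x → put g v x v ≡ x
  put-hit g v x with v Fin.≟ v
  ... | yes _ = refl
  ... | no ne = contradiction refl ne

  put-miss : ∀ g v x {u} → v ≢ u → put g v x u ≡ g u
  put-miss g v x {u} ne with v Fin.≟ u
  ... | yes e = contradiction e ne
  ... | no _ = refl

  ≗ᶠ-update : ∀ {f g v j x y} → f ≗ᶠ g → j ≡ toℕ v → x ≡ y → update f j x ≗ᶠ put g v y
  ≗ᶠ-update {f} {g} {v} {x = x} {y} (pointwise r) refl e = pointwise go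
    where
    go : ∀ u → update f (toℕ v) x (toℕ u) ≡ put g v y u
    go u with v Fin.≟ u
    ... | yes refl = trans (update-hit f _ refl) e
    ... | no ne = trans (update-miss f _ (λ e → ne (Fin.toℕ-injective e))) (r u)

-- The program

-- Registers: 0 holds N, 1 the loop counter, 2 the size b, 3 the threshold q;
-- the others are temporary.  Arrays: 0 parents, 1 the current order, 2 to 4
-- pointer jumping, 5 sorting keys (depths, then block roots), 6 the nodes by
-- depth, 7 levels, 8 block sizes, 9 counters, 10 sorted output.

clear tally accumulate distribute collect sort : Program
clear      = 9 [ reg 1 ]≔ lit 0
tally      = 9 [ cell 5 (reg 1) ]≔ cell 9 (cell 5 (reg 1)) ⊕ lit 1
-- Replaces the counts by starting positions, with the running sum in register 6.
accumulate = 7 ≔ cell 9 (reg 1) ⨾ 9 [ reg 1 ]≔ reg 6 ⨾ 6 ≔ reg 6 ⊕ reg 7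
-- Taking the nodes in the current order, from array 1, is what makes the sort stable.
distribute = 4 ≔ cell 1 (reg 1) ⨾ 5 ≔ cell 5 (reg 4) ⨾ 10 [ cell 9 (reg 5) ]≔ reg 4 ⨾
             9 [ reg 5 ]≔ cell 9 (reg 5) ⊕ lit 1
collect    = 1 [ reg 1 ]≔ cell 10 (reg 1)
sort       = for clear ⨾ for tally ⨾ 6 ≔ lit 0 ⨾ for accumulate ⨾ for distribute ⨾ for collect

sortTime : ℕ
sortTime = forTime clear + (forTime tally + (1 + (forTime accumulate + (forTime distribute + forTime collect))))

module SortRun (A : BlackBox) {N : ℕ} (t : Tree N)
  (F : ℕ → ℕ → (ℕ → ℕ) → (ℕ → ℕ) → Set) (π : Permutation′ N) (key : Fin N → Fin N) where
  open Machine A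
  open Levels t
  open Sorting t
  open Arrays {N}

  -- `F` carries what the caller knows about registers 2 and 3 and arrays 0 and 6, none of which the
  -- sort writes.
  Frame : State → Set
  Frame σ = regs σ 0 ≡ N × F (regs σ 2) (regs σ 3) (mem σ 0) (mem σ 6)

  Base : State → Set
  Base σ = Frame σ × mem σ 5 ≗ᶠ (λ v → toℕ (key v)) × mem σ 1 ≗ᶠ (λ i → toℕ (π ⟨$⟩ʳ i))

  Clearing Counting Accumulating Distributing : ℕ → State → Set
  Clearing i σ = Base σ × Filled i (mem σ 9) (λ _ → 0)
  -- The tally visits the nodes by number, that is, in the order `Perm.id`.
  Counting i σ = Base σ × mem σ 9 ≗ᶠ (λ κ → # (earlier? Perm.id key κ i))
  Accumulating i σ = Base σ × regs σ 6 ≡ # (less? π key i) ×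
    (∀ κ → (toℕ κ < i → mem σ 9 (toℕ κ) ≡ # (less? π key (toℕ κ))) ×
           (i ≤ toℕ κ → mem σ 9 (toℕ κ) ≡ # (equal? π key κ)))
  -- Each counter holds the place of the next node with its key.
  Distributing i σ = Base σ × mem σ 9 ≗ᶠ (λ κ → # (less? π key (toℕ κ)) + # (earlier? π key κ i)) ×
    (∀ v → slot π v < i → mem σ 10 (place π key v) ≡ toℕ v)

  Placed : State → Set
  Placed σ = Frame σ × (∀ v → mem σ 10 (place π key v) ≡ toℕ v)

  Collecting : Permutation′ N → ℕ → State → Set
  Collecting π′ i σ = Placed σ × Filled i (mem σ 1) (λ i → toℕ (π′ ⟨$⟩ʳ i))

  run-clear : ∀ σ → Base σ → Linear {A} N (for clear) (Clearing N) (forTime clear) σ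
  run-clear σ B = for-rule clear Clearing (λ (((e , _) , _) , _) → e)
    (λ i σ r (B , F) → r , B , filled-suc i F r refl) σ (B , filled-0)

  run-tally : ∀ σ → Clearing N σ → Linear {A} N (for tally) (Counting N) (forTime tally) σ
  run-tally σ (B , F) = for-rule tally Counting (λ (((e , _) , _) , _) → e) step σ
    (B , pointwise λ κ → trans (at (filled-N F) κ) (sym (#-earlier-0 Perm.id key κ)))
    where
    step : ∀ i σ → regs σ 1 ≡ toℕ i → Counting (toℕ i) σ →
      wp tally (λ σ′ → regs σ′ 1 ≡ toℕ i × Counting (suc (toℕ i)) (setReg σ′ 1 (suc (toℕ i)))) σ
    step i σ r (B@(_ , k5 , _) , c) = r , B , pointwise λ κ → trans
      (at (≗ᶠ-update c k (trans (cong (λ x → mem σ 9 x + 1) k) (trans (cong (_+ 1) (at c (key i))) (+-comm _ 1)))) κ) (next κ)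
      where
      k : mem σ 5 (regs σ 1) ≡ toℕ (key i)
      k = trans (cong (mem σ 5) r) (at k5 i)
      next : ∀ κ → put (λ κ → # (earlier? Perm.id key κ (toℕ i))) (key i) (suc (# (earlier? Perm.id key (key i) (toℕ i)))) κ
             ≡ # (earlier? Perm.id key κ (suc (toℕ i)))
      next κ with key i Fin.≟ κ
      ... | yes refl = sym (#-earlier-hit Perm.id key {i})
      ... | no ne = sym (#-earlier-miss Perm.id key ne)

  run-accumulate : ∀ σ → Accumulating 0 σ → Linear {A} N (for accumulate) (Accumulating N) (forTime accumulate) σ
  run-accumulate σ S = for-rule accumulate Accumulating (λ (((e , _) , _) , _) → e) step σ S
    where
    step : ∀ i σ → regs σ 1 ≡ toℕ i → Accumulating (toℕ i) σ →
      wp accumulate (λ σ′ → regs σ′ 1 ≡ toℕ i × Accumulating (suc (toℕ i)) (setReg σ′ 1 (suc (toℕ i)))) σ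
    step i σ r (B , total , c) = r , B ,
      trans (cong₂ _+_ total (trans (cong (mem σ 9) r) (proj₂ (c i) ≤-refl))) (sym (#-less-suc π key i)) ,
      λ κ → done κ , λ lt → trans (update-miss (mem σ 9) (regs σ 6) (λ e → <⇒≢ lt (trans (sym r) e))) (proj₂ (c κ) (<⇒≤ lt))
      where
      done : ∀ κ → toℕ κ < suc (toℕ i) → update (mem σ 9) (regs σ 1) (regs σ 6) (toℕ κ) ≡ # (less? π key (toℕ κ))
      done κ lt with m≤n⇒m<n∨m≡n (s≤s⁻¹ lt)
      ... | inj₁ l = trans (update-miss (mem σ 9) _ (λ e → <⇒≢ l (trans (sym e) r))) (proj₁ (c κ) l)
      ... | inj₂ e = trans (update-hit (mem σ 9) _ (trans r (sym e))) (trans total (cong (λ k → # (less? π key k)) (sym e)))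

  run-distribute : ∀ σ → Accumulating N σ → Linear {A} N (for distribute) (Distributing N) (forTime distribute) σ
  run-distribute σ (B , _ , c) = for-rule distribute Distributing (λ (((e , _) , _) , _) → e) step σ
    (B , (pointwise λ κ → trans (proj₁ (c κ) (Fin.toℕ<n κ)) (sym (trans (cong (# (less? π key (toℕ κ)) +_) (#-earlier-0 π key κ)) (+-identityʳ _)))) , λ v ())
    where
    step : ∀ i σ → regs σ 1 ≡ toℕ i → Distributing (toℕ i) σ →
      wp distribute (λ σ′ → regs σ′ 1 ≡ toℕ i × Distributing (suc (toℕ i)) (setReg σ′ 1 (suc (toℕ i)))) σ
    step i σ r (B@(_ , k5 , o1) , c , d) = r , B ,
      (pointwise λ κ → trans (at (≗ᶠ-update c kv (trans (cong (λ x → mem σ 9 x + 1) kv) (trans (cong (_+ 1) (at c (key v))) (+-comm _ 1)))) κ) (next κ)) ,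
      done
      where
      v = π ⟨$⟩ʳ i
      sv : slot π v ≡ toℕ i
      sv = cong toℕ (inverseˡ π)
      ov : mem σ 1 (regs σ 1) ≡ toℕ v
      ov = trans (cong (mem σ 1) r) (at o1 i)
      kv : mem σ 5 (mem σ 1 (regs σ 1)) ≡ toℕ (key v)
      kv = trans (cong (mem σ 5) ov) (at k5 v)
      pv : mem σ 9 (mem σ 5 (mem σ 1 (regs σ 1))) ≡ place π key v
      pv = trans (cong (mem σ 9) kv) (trans (at c (key v)) (cong (λ s → # (less? π key (toℕ (key v))) + # (earlier? π key (key v) s)) (sym sv)))
      next : ∀ κ → put (λ κ → # (less? π key (toℕ κ)) + # (earlier? π key κ (toℕ i))) (key v)
                 (suc (# (less? π key (toℕ (key v))) + # (earlier? π key (key v) (toℕ i)))) κ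
             ≡ # (less? π key (toℕ κ)) + # (earlier? π key κ (suc (toℕ i)))
      next κ with key v Fin.≟ κ
      ... | yes refl = trans (sym (+-suc _ _)) (cong (# (less? π key (toℕ (key v))) +_)
              (subst (λ s → suc (# (earlier? π key (key v) s)) ≡ # (earlier? π key (key v) (suc s))) sv (sym (#-earlier-hit π key {v}))))
      ... | no ne = cong (# (less? π key (toℕ κ)) +_)
              (subst (λ s → # (earlier? π key κ s) ≡ # (earlier? π key κ (suc s))) sv (sym (#-earlier-miss π key ne)))
      done : ∀ u → slot π u < suc (toℕ i) →
        update (mem σ 10) (mem σ 9 (mem σ 5 (mem σ 1 (regs σ 1)))) (mem σ 1 (regs σ 1)) (place π key u) ≡ toℕ u
      done u lt with u Fin.≟ v
      ... | yes refl = trans (update-hit (mem σ 10) _ pv) ov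
      ... | no ne = trans (update-miss (mem σ 10) _ (λ e → ne (place-injective π key (sym (trans (sym pv) e)))))
        (d u (≤∧≢⇒< (s≤s⁻¹ lt) (λ e → ne (slot-injective π (trans e (sym sv))))))

  run-collect : ∀ π′ → (∀ v → slot π′ v ≡ place π key v) → ∀ σ → Distributing N σ →
    Linear {A} N (for collect) (Collecting π′ N) (forTime collect) σ
  run-collect π′ slot≡ σ ((Fr , _) , _ , d) = for-rule collect (Collecting π′) (λ (((e , _) , _) , _) → e) step σ
    ((Fr , λ v → d v (Fin.toℕ<n (π ⟨$⟩ˡ v))) , filled-0)
    where
    step : ∀ i σ → regs σ 1 ≡ toℕ i → Collecting π′ (toℕ i) σ →
      wp collect (λ σ′ → regs σ′ 1 ≡ toℕ i × Collecting π′ (suc (toℕ i)) (setReg σ′ 1 (suc (toℕ i)))) σ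
    step i σ r ((Fr , p) , f) = r , (Fr , p) , filled-suc i f r
      (trans (cong (mem σ 10) (trans r (trans (sym (cong toℕ (inverseˡ π′))) (slot≡ (π′ ⟨$⟩ʳ i))))) (p (π′ ⟨$⟩ʳ i)))

  run-sort : ∀ π′ → (∀ v → slot π′ v ≡ place π key v) → ∀ σ → Base σ →
    Linear {A} N sort (λ σ → Frame σ × mem σ 1 ≗ᶠ (λ i → toℕ (π′ ⟨$⟩ʳ i))) sortTime σ
  run-sort π′ slot≡ σ B =
    linear-seq (forTime clear) (run-clear σ B) λ σ S →
    linear-seq (forTime tally) (run-tally σ S) λ σ (B , c) →
    linear-seq {Q = Accumulating 0} 1 (linear-const (_ , _ , assign ,
      (B , sym (#-less-0 π key) , λ κ → (λ ()) , λ _ → trans (at c κ) (#-earlier-N Perm.id key κ)) , ≤-refl)) λ σ S →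
    linear-seq (forTime accumulate) (run-accumulate σ S) λ σ S →
    linear-seq (forTime distribute) (run-distribute σ S) λ σ S →
    linear-weaken (λ σ ((Fr , _) , f) → Fr , filled-N f) ≤-refl (run-collect π′ slot≡ σ S)

-- The invariant of the refinement and the approximation factor

module Quality {N : ℕ} (t : Tree N) where
  open Levels t

  -- What holds before size `b` is tried. `current` is the account opened by the layout kept last,
  -- available for larger sizes; `handled` settles the smaller sizes, compared with an arbitrary
  -- partition so that no optimum has to be singled out.
  record Good (b : ℕ) (π : Permutation′ N) (q : ℕ) : Set where
    field
      current : ∃[ w ] (Pieces π w q q × 0 < w × w ≤ b)
      handled : ∀ (blk : Fin N → ℕ) B → 0 < B → B < b → (∀ j → # (λ u → blk u ≟ j) ≤ B) →
        ∃[ w ] ∃[ G ] (Pieces π w q G × 0 < w × w ≤ B × G ≤ 8 * maxBlockCost t blk)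

  good-start : ∀ π → Good 1 π N
  good-start π = record
    { current = 1 , initial-pieces π , z<s , ≤-refl
    ; handled = λ blk B 0<B B<1 → contradiction 0<B (<⇒≱ B<1) }

  module _ {b h top} (0<b : 0 < b) (L : Clustering b h top) {π q} (good : Good b π q) where
    open Good good

    private
      g : ℕ
      g = suc (h (root t))

      g≤4cost : ∀ blk B → B < b + b → (∀ j → # (λ u → blk u ≟ j) ≤ B) → g ≤ 4 * maxBlockCost t blk
      g≤4cost blk B lt le = LowerBound.levels≤4cost (Clustering.greedy L) 0<b blk λ j → ≤-trans (le j) (<⇒≤ lt)

    -- Sizes from `b` up to `b + b` are served by the layout kept last: its width is at most `b`,
    -- and its threshold is below `g + g`, hence at most 8 times the cost of any competitor.
    good-keep : q < g + g → Good (b + b) π q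
    good-keep lt = record
      { current = let w , P , 0<w , w≤b = current in w , P , 0<w , ≤-trans w≤b (m≤m+n b b)
      ; handled = handled′ }
      where
      handled′ : ∀ (blk : Fin N → ℕ) B → 0 < B → B < b + b → (∀ j → # (λ u → blk u ≟ j) ≤ B) →
        ∃[ w ] ∃[ G ] (Pieces π w q G × 0 < w × w ≤ B × G ≤ 8 * maxBlockCost t blk)
      handled′ blk B 0<B B<2b le with B <? b
      ... | yes B<b = handled blk B 0<B B<b le
      ... | no B≮b = let w , P , 0<w , w≤b = current in w , q , P , 0<w , ≤-trans w≤b (≮⇒≥ B≮b) , (begin
          q                                                   ≤⟨ <⇒≤ lt ⟩
          g + g
            ≤⟨ +-mono-≤ (g≤4cost blk B B<2b le) (g≤4cost blk B B<2b le) ⟩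
          4 * maxBlockCost t blk + 4 * maxBlockCost t blk     ≡⟨ *-distribʳ-+ (maxBlockCost t blk) 4 4 ⟨
          8 * maxBlockCost t blk                              ∎)
        where open ≤-Reasoning

    -- Sizes below `b` extend their old account by `add-level`, leaving `G` and its bound untouched;
    -- those from `b` up to `b + b` open one by `new-level`.
    good-add : ∀ {π′} → Refines top π π′ → g + g ≤ q → Good (b + b) π′ g
    good-add {π′} R le = record
      { current = b , new-level L R , 0<b , m≤m+n b b
      ; handled = handled′ }
      where
      handled′ : ∀ (blk : Fin N → ℕ) B → 0 < B → B < b + b → (∀ j → # (λ u → blk u ≟ j) ≤ B) →
        ∃[ w ] ∃[ G ] (Pieces π′ w g G × 0 < w × w ≤ B × G ≤ 8 * maxBlockCost t blk)
      handled′ blk B 0<B B<2b bd with B <? b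
      ... | yes B<b = let w , G , P , 0<w , w≤B , G≤ = handled blk B 0<B B<b bd in
        w , G , add-level L R 0<w le P , 0<w , w≤B , G≤
      ... | no B≮b = b , g , new-level L R , 0<b , ≮⇒≥ B≮b ,
        ≤-trans (g≤4cost blk B B<2b bd) (*-monoˡ-≤ (maxBlockCost t blk) (m≤m+n 4 4))

  -- A block size of at least `b` exceeds `N`, and is treated as `N`: no partition has a block of
  -- more than `N` nodes, and pieces of width at most `N` are short for it as well.
  good⇒cost : ∀ {b π q} → Good b π q → N < b → ∀ B .{{_ : NonZero B}} (s : Fin B) m →
    IsMinCost t B m → linearCost t π B s ≤ 48 * m
  good⇒cost {b} {π} good N<b B s m ((L , refl) , _) = conclude (handled-at (B <? b))
    where
    open Good good
    blk : Fin N → ℕ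
    blk v = toℕ (lookup (blocks L) v)

    #-blk : ∀ j → # (λ u → blk u ≟ j) ≤ B
    #-blk j with j <? N
    ... | yes j<N = ≤-trans (#-mono (λ u → blk u ≟ j) (λ u → lookup (blocks L) u Fin.≟ fromℕ< j<N)
          (λ u e → Fin.toℕ-injective (trans e (sym (Fin.toℕ-fromℕ< j<N)))))
          (≤-trans (≤-reflexive (sym (count-# (Fin._≟ fromℕ< j<N) (blocks L)))) (bounded L (fromℕ< j<N)))
    ... | no j≮N = ≤-trans (≤-reflexive (#-∅ (λ u → blk u ≟ j) λ u e → j≮N (subst (_< N) e (Fin.toℕ<n _)))) z≤n

    handled-at : Dec (B < b) → ∃[ w ] ∃[ G ] ∃[ q ] (Pieces π w q G × w ≤ B × G ≤ 8 * maxBlockCost t blk)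
    handled-at (yes B<b) = let w , G , P , _ , w≤B , G≤ = handled blk B (>-nonZero⁻¹ B) B<b #-blk in w , G , _ , P , w≤B , G≤
    handled-at (no B≮b) = let w , G , P , _ , w≤N , G≤ = handled blk N (≤-<-trans z≤n (Fin.toℕ<n (root t))) N<b (λ j → #≤n (λ u → blk u ≟ j)) in
      w , G , _ , P , ≤-trans w≤N (≤-trans (<⇒≤ N<b) (≮⇒≥ B≮b)) , G≤

    conclude : ∃[ w ] ∃[ G ] ∃[ q ] (Pieces π w q G × w ≤ B × G ≤ 8 * maxBlockCost t blk) →
      linearCost t π B s ≤ 48 * maxBlockCost t blk
    conclude (w , G , q , P , w≤B , G≤) = begin
      linearCost t π B s               ≤⟨ pieces⇒cost P B s w≤B ⟩
      6 * G                            ≤⟨ *-monoʳ-≤ 6 G≤ ⟩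
      6 * (8 * maxBlockCost t blk)     ≡⟨ *-assoc 6 8 (maxBlockCost t blk) ⟨
      48 * maxBlockCost t blk          ∎
      where open ≤-Reasoning

-- Depths by pointer jumping

initialise double-up copy-back jump order-by-depth : Program
initialise = 1 [ reg 1 ]≔ reg 1 ⨾ 2 [ reg 1 ]≔ cell 0 (reg 1) ⨾
  -- The sum of the two truncated differences is the distance between the labels of node and parent,
  -- which vanishes only at the root; `1 ∸ (1 ∸ x)` reduces it to 0 or 1.
  5 [ reg 1 ]≔ lit 1 ⊖ (lit 1 ⊖ ((cell 0 (reg 1) ⊖ reg 1) ⊕ (reg 1 ⊖ cell 0 (reg 1))))
-- Results go to arrays 3 and 4, since later rounds still read the old values at other nodes.
double-up = 3 [ reg 1 ]≔ cell 5 (reg 1) ⊕ cell 5 (cell 2 (reg 1)) ⨾ 4 [ reg 1 ]≔ cell 2 (cell 2 (reg 1))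
copy-back = 5 [ reg 1 ]≔ cell 3 (reg 1) ⨾ 2 [ reg 1 ]≔ cell 4 (reg 1)
jump = for double-up ⨾ for copy-back
order-by-depth = 6 [ reg 1 ]≔ cell 1 (reg 1)

jumpTime : ℕ
jumpTime = forTime double-up + forTime copy-back

module DepthRun (A : BlackBox) {N : ℕ} (t : Tree N) where
  open Machine A
  open Rooted t
  open Levels t
  open Sorting t
  open Arrays {N}

  private
    par : Fin N → Fin N
    par = parent t

  Input : State → Set
  Input σ = regs σ 0 ≡ N × mem σ 0 ≗ᶠ (λ v → toℕ (par v))

  Initialising : ℕ → State → Set
  Initialising i σ = Input σ × Filled i (mem σ 1) toℕ × Filled i (mem σ 2) (λ v → toℕ (par v)) ×
    Filled i (mem σ 5) (λ v → depth v ⊓ 1)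

  run-initialise : ∀ σ → Input σ → Linear {A} N (for initialise) (Initialising N) (forTime initialise) σ
  run-initialise σ I = for-rule initialise Initialising (λ ((e , _) , _) → e) step σ (I , filled-0 , filled-0 , filled-0)
    where
    is-root : ∀ v → 1 ∸ (1 ∸ ((toℕ (par v) ∸ toℕ v) + (toℕ v ∸ toℕ (par v)))) ≡ depth v ⊓ 1
    is-root v with v Fin.≟ root t
    ... | yes refl rewrite root-parent t | depth-root | n∸n≡0 (toℕ (root t)) = refl
    ... | no v≢r rewrite depth-suc v≢r | ⊓-zeroʳ (depth (par v)) with (toℕ (par v) ∸ toℕ v) + (toℕ v ∸ toℕ (par v)) in eq
    ...   | suc x = cong (1 ∸_) (0∸n≡0 x)
    ...   | zero = contradiction (cong depth (Fin.toℕ-injective (≤-antisym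
              (m∸n≡0⇒m≤n (m+n≡0⇒m≡0 _ eq)) (m∸n≡0⇒m≤n (m+n≡0⇒n≡0 (toℕ (par v) ∸ toℕ v) eq)))))
              (λ e → 1+n≢n (trans (sym (depth-suc v≢r)) (sym e)))
    step : ∀ i σ → regs σ 1 ≡ toℕ i → Initialising (toℕ i) σ →
      wp initialise (λ σ′ → regs σ′ 1 ≡ toℕ i × Initialising (suc (toℕ i)) (setReg σ′ 1 (suc (toℕ i)))) σ
    step i σ r (I@(_ , m0) , f1 , f2 , f5) = r , I , filled-suc i f1 r r , filled-suc i f2 r pi ,
      filled-suc i f5 r (trans (cong₂ (λ a b → 1 ∸ (1 ∸ ((a ∸ b) + (b ∸ a)))) pi r) (is-root i))
      where
      pi : mem σ 0 (regs σ 1) ≡ toℕ (par i)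
      pi = trans (cong (mem σ 0) r) (at m0 i)

  -- Depths are known up to the cap `b`, along with the `b`-th ancestors. The depth up to `b + b` is
  -- the capped depth of the node plus that of its `b`-th ancestor; at the root, its own parent,
  -- both pointers and depths stay put.
  Jumping : ℕ → State → Set
  Jumping b σ = Input σ × regs σ 2 ≡ b × mem σ 1 ≗ᶠ toℕ × mem σ 2 ≗ᶠ (λ v → toℕ (up b v)) ×
    mem σ 5 ≗ᶠ (λ v → depth v ⊓ b)

  Doubling : ℕ → ℕ → State → Set
  Doubling b i σ = Jumping b σ × Filled i (mem σ 3) (λ v → depth v ⊓ (b + b)) × Filled i (mem σ 4) (λ v → toℕ (up (b + b) v))

  Copying : ℕ → ℕ → State → Set
  Copying b i σ = (Input σ × regs σ 2 ≡ b × mem σ 1 ≗ᶠ toℕ × mem σ 3 ≗ᶠ (λ v → depth v ⊓ (b + b)) × mem σ 4 ≗ᶠ (λ v → toℕ (up (b + b) v))) ×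
    Filled i (mem σ 5) (λ v → depth v ⊓ (b + b)) × Filled i (mem σ 2) (λ v → toℕ (up (b + b) v))

  ⊓-double : ∀ m b → m ⊓ b + (m ∸ b) ⊓ b ≡ m ⊓ (b + b)
  ⊓-double m b with ≤-total m b
  ... | inj₁ m≤b rewrite m≤n⇒m∸n≡0 m≤b | m≤n⇒m⊓n≡m m≤b | m≤n⇒m⊓n≡m (≤-trans m≤b (m≤m+n b b)) = +-identityʳ m
  ... | inj₂ b≤m rewrite m≥n⇒m⊓n≡n b≤m = trans (+-distribˡ-⊓ b (m ∸ b) b) (cong (_⊓ (b + b)) (m+[n∸m]≡n b≤m))

  jump-linear : ∀ b σ → Jumping b σ → Linear {A} N jump
    (λ σ′ → regs σ′ 2 ≡ b × Jumping (b + b) (setReg σ′ 2 (b + b))) jumpTime σ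
  jump-linear b σ J = linear-seq (forTime double-up)
    (for-rule double-up (Doubling b) (λ (((e , _) , _) , _) → e) step₁ σ (J , filled-0 , filled-0))
    λ σ ((I , r2 , m1 , _ , _) , f3 , f4) →
    linear-weaken (λ σ ((I , r2 , m1 , _ , _) , f5 , f2) → r2 , I , refl , m1 , filled-N f2 , filled-N f5) ≤-refl
    (for-rule copy-back (Copying b) (λ (((e , _) , _) , _) → e) step₂ σ
      ((I , r2 , m1 , filled-N f3 , filled-N f4) , filled-0 , filled-0))
    where
    step₁ : ∀ i σ → regs σ 1 ≡ toℕ i → Doubling b (toℕ i) σ →
      wp double-up (λ σ′ → regs σ′ 1 ≡ toℕ i × Doubling b (suc (toℕ i)) (setReg σ′ 1 (suc (toℕ i)))) σ
    step₁ i σ r (J@(_ , _ , _ , m2 , m5) , f3 , f4) = r , J ,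
      filled-suc i f3 r (trans (cong₂ _+_ (trans (cong (mem σ 5) r) (at m5 i)) (trans (cong (mem σ 5) u) (at m5 (up b i))))
        (trans (cong (λ d → depth i ⊓ b + d ⊓ b) (depth-up b i)) (⊓-double (depth i) b))) ,
      filled-suc i f4 r (trans (cong (mem σ 2) u) (trans (at m2 (up b i)) (cong toℕ (sym (up-+ b b i)))))
      where
      u : mem σ 2 (regs σ 1) ≡ toℕ (up b i)
      u = trans (cong (mem σ 2) r) (at m2 i)
    step₂ : ∀ i σ → regs σ 1 ≡ toℕ i → Copying b (toℕ i) σ →
      wp copy-back (λ σ′ → regs σ′ 1 ≡ toℕ i × Copying b (suc (toℕ i)) (setReg σ′ 1 (suc (toℕ i)))) σ
    step₂ i σ r (C@(_ , _ , _ , m3 , m4) , f5 , f2) = r , C ,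
      filled-suc i f5 r (trans (cong (mem σ 3) r) (at m3 i)) , filled-suc i f2 r (trans (cong (mem σ 4) r) (at m4 i))

  run-jump : ∀ b σ → 0 < b → Jumping b σ →
    Run jump (λ σ′ → regs σ′ 2 ≡ b × Jumping (b + b) (setReg σ′ 2 (b + b))) (jumpTime * suc N) σ
  run-jump b σ _ J = Linear.run (jump-linear b σ J)

  depth-key : Fin N → Fin N
  depth-key v = fromℕ< (depth<N v)

  -- Places every parent before its children, so that one scan backwards is a bottom-up pass and one
  -- scan forwards a top-down pass.
  depth-order : Σ[ ρ ∈ Permutation′ N ] ((∀ v → slot ρ v ≡ place Perm.id depth-key v) ×
             (∀ u v → depth u < depth v → slot ρ u < slot ρ v))
  depth-order = reorder (sorted Perm.id depth-key)
    where
    reorder : Σ[ π ∈ Permutation′ N ] ((∀ v → slot π v ≡ place Perm.id depth-key v) × Refines depth-key Perm.id π ×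
                (∀ u v → toℕ (depth-key u) < toℕ (depth-key v) → slot π u < slot π v)) →
              Σ[ ρ ∈ Permutation′ N ] ((∀ v → slot ρ v ≡ place Perm.id depth-key v) ×
                (∀ u v → depth u < depth v → slot ρ u < slot ρ v))
    reorder (ρ , slot≡ , _ , ordered) = ρ , slot≡ , λ u v lt → ordered u v
      (subst₂ _<_ (sym (Fin.toℕ-fromℕ< (depth<N u))) (sym (Fin.toℕ-fromℕ< (depth<N v))) lt)

setup : Program
setup = for initialise ⨾ doubling jump ⨾ sort ⨾ for order-by-depth

setupTime : ℕ → ℕ → ℕ
setupTime N f = forTime initialise * suc N + ((2 + f * (jumpTime * suc N + 2)) + (sortTime + forTime order-by-depth) * suc N)

module SetupRun (A : BlackBox) {N : ℕ} (t : Tree N) (ρ : Permutation′ N) where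
  open Machine A
  open Rooted t
  open Levels t
  open Sorting t
  open Arrays {N}
  open DepthRun A t

  Recording : ℕ → State → Set
  Recording i σ = Input σ × mem σ 1 ≗ᶠ (λ i → toℕ (ρ ⟨$⟩ʳ i)) × Filled i (mem σ 6) (λ i → toℕ (ρ ⟨$⟩ʳ i))

  depth-stored : ∀ {b m} → N < b → m ≗ᶠ (λ v → depth v ⊓ b) → m ≗ᶠ (λ v → toℕ (depth-key v))
  depth-stored N<b (pointwise r) = pointwise λ v → trans (r v)
    (trans (m≤n⇒m⊓n≡m (<⇒≤ (<-trans (depth<N v) N<b))) (sym (Fin.toℕ-fromℕ< (depth<N v))))

  open SortRun A t (λ _ _ m0 _ → m0 ≗ᶠ (λ v → toℕ (parent t v))) Perm.id depth-key

  run-record : ∀ σ → Frame σ × mem σ 1 ≗ᶠ (λ i → toℕ (ρ ⟨$⟩ʳ i)) →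
    Linear {A} N (for order-by-depth) (Recording N) (forTime order-by-depth) σ
  run-record σ (I , m1) = for-rule order-by-depth Recording (λ ((e , _) , _) → e)
      (λ i σ r (I , m1 , f6) → r , I , m1 , filled-suc i f6 r (trans (cong (mem σ 1) r) (at m1 i))) σ (I , m1 , filled-0)

  sort-base : ∀ b σ → N < b → Jumping b σ → Base σ
  sort-base b σ N<b ((e , m0) , _ , m1 , _ , m5) = (e , m0) , depth-stored N<b m5 , m1

  run-order : (∀ v → slot ρ v ≡ place Perm.id depth-key v) → ∀ b σ → N < b → Jumping b σ →
    Linear {A} N (sort ⨾ for order-by-depth) (Recording N) (sortTime + forTime order-by-depth) σ
  run-order slot≡ b σ N<b J = linear-seq sortTime (run-sort ρ slot≡ σ (sort-base b σ N<b J)) run-record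

  run-setup : (∀ v → slot ρ v ≡ place Perm.id depth-key v) → ∀ f → N < 2 ^ f → ∀ σ → Input σ →
    Run setup (Recording N) (setupTime N f) σ
  run-setup slot≡ f N<2^f σ I =
    run-seq (Linear.run (run-initialise σ I)) λ σ (I , f1 , f2 , f5) →
    run-seq (doubling-rule jump Jumping (jumpTime * suc N) (λ ((e , _) , r , _) → e , r) run-jump σ
      (I , refl , filled-N f1 , filled-N f2 , filled-N f5) f N<2^f) λ σ (b , N<b , J) →
    Linear.run (run-order slot≡ b σ N<b J)

-- One greedy layout on the machine

prepare close push ascend descend-tops select refine-level : Program
prepare = 7 [ reg 1 ]≔ lit 0 ⨾ 8 [ reg 1 ]≔ lit 1 ⨾ 5 [ reg 1 ]≔ reg 1
-- Array 6 is read from its end, children before parents.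
close = 4 ≔ cell 6 (reg 0 ⊖ (reg 1 ⊕ lit 1)) ⨾
  cond (cell 8 (reg 4) ⊖ reg 2) (7 [ reg 4 ]≔ cell 7 (reg 4) ⊕ lit 1 ⨾ 8 [ reg 4 ]≔ lit 1) skip
push = 5 ≔ cell 0 (reg 4) ⨾
  cond (cell 7 (reg 4) ⊖ cell 7 (reg 5))
    (7 [ reg 5 ]≔ cell 7 (reg 4) ⨾ 8 [ reg 5 ]≔ cell 8 (reg 4) ⊕ lit 1)
    (cond (cell 7 (reg 5) ⊖ cell 7 (reg 4)) skip (8 [ reg 5 ]≔ cell 8 (reg 5) ⊕ cell 8 (reg 4)))
ascend = close ⨾ push
descend-tops = 4 ≔ cell 6 (reg 1) ⨾ 5 ≔ cell 0 (reg 4) ⨾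
  -- Levels never decrease upwards, so the difference is zero only if node and parent share a block.
  cond (cell 7 (reg 5) ⊖ cell 7 (reg 4)) skip (5 [ reg 4 ]≔ cell 5 (reg 5))
select = 7 ≔ cell 7 (cell 6 (lit 0)) ⊕ lit 1 ⨾
  -- Nonzero means `q < g + g`: the layout is dropped.
  cond (reg 7 ⊕ reg 7 ⊖ reg 3) skip (3 ≔ reg 7 ⨾ sort)
refine-level = for prepare ⨾ for ascend ⨾ for descend-tops ⨾ select

selectTime levelTime : ℕ
selectTime = 1 + (1 + (1 + sortTime))
levelTime = forTime prepare + (forTime ascend + (forTime descend-tops + selectTime))

module LevelRun (A : BlackBox) {N : ℕ} (t : Tree N) (ρ : Permutation′ N)
  (ordered : ∀ u v → Rooted.depth t u < Rooted.depth t v → toℕ (ρ ⟨$⟩ˡ u) < toℕ (ρ ⟨$⟩ˡ v))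
  (b : ℕ) (0<b : 0 < b) (π : Permutation′ N) (q : ℕ) where
  open Machine A
  open Rooted t
  open Levels t
  open Sorting t
  open Passes t b 0<b
  open Arrays {N}

  private
    par : Fin N → Fin N
    par = parent t

  Context : State → Set
  Context σ = regs σ 0 ≡ N × regs σ 2 ≡ b × regs σ 3 ≡ q × mem σ 0 ≗ᶠ (λ v → toℕ (par v)) ×
    mem σ 1 ≗ᶠ node π × mem σ 6 ≗ᶠ node ρ

  Preparing : ℕ → State → Set
  Preparing i σ = Context σ × Filled i (mem σ 7) (λ _ → 0) × Filled i (mem σ 8) (λ _ → 1) × Filled i (mem σ 5) toℕ

  run-prepare : ∀ σ → Context σ → Linear {A} N (for prepare) (Preparing N) (forTime prepare) σ
  run-prepare σ C = for-rule prepare Preparing (λ ((e , _) , _) → e)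
    (λ i σ r (C , f7 , f8 , f5) → r , C , filled-suc i f7 r refl , filled-suc i f8 r refl , filled-suc i f5 r r)
    σ (C , filled-0 , filled-0 , filled-0)

  -- The last `j` places of the depth order. Descendants are deeper and hence come later, so such a
  -- set contains all descendants of its members.
  Done : ℕ → Fin N → Set
  Done j u = N ≤ slot ρ u + j

  done? : ∀ j → Decidable (Done j)
  done? j u = N ≤? slot ρ u + j

  slot-⊒ : ∀ {v u} → v ⊒ u → slot ρ v ≤ slot ρ u
  slot-⊒ v⊒u with ⊒⇒≡⊎⊐ v⊒u
  ... | inj₁ refl = ≤-refl
  ... | inj₂ (_ , lt) = <⇒≤ (ordered _ _ lt)

  done-closed : ∀ j → Closed (done? j)
  done-closed j d v⊒u = ≤-trans d (+-monoˡ-≤ j (slot-⊒ v⊒u))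

  Ascending : ℕ → State → Set
  Ascending j σ = Context σ × mem σ 5 ≗ᶠ toℕ × ∃[ h ] ∃[ s ] (mem σ 7 ≗ᶠ h × mem σ 8 ≗ᶠ s × Partial (done? j) h s)

  module Ascend (i : Fin N) where
    v p : Fin N
    v = ρ ⟨$⟩ʳ Fin.opposite i
    p = par v

    slot-v : slot ρ v ≡ N ∸ suc (toℕ i)
    slot-v = trans (cong toℕ (inverseˡ ρ)) (Fin.opposite-prop i)

    slot+ : slot ρ v + suc (toℕ i) ≡ N
    slot+ = trans (cong (_+ suc (toℕ i)) slot-v) (m∸n+n≡m (Fin.toℕ<n i))

    done-old : ∀ {u} → Done (toℕ i) u → Done (suc (toℕ i)) u
    done-old d = ≤-trans d (+-monoʳ-≤ _ (n≤1+n _))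

    done-now : Done (suc (toℕ i)) v
    done-now = ≤-reflexive (sym slot+)

    done-only : ∀ {u} → Done (suc (toℕ i)) u → Done (toℕ i) u ⊎ u ≡ v
    done-only {u} d with m≤n⇒m<n∨m≡n d
    ... | inj₁ lt = inj₁ (s≤s⁻¹ (subst (N <_) (+-suc (slot ρ u) (toℕ i)) lt))
    ... | inj₂ e = inj₂ (slot-injective ρ (+-cancelʳ-≡ (suc (toℕ i)) _ _ (trans (sym e) (sym slot+))))

    v∉ : ¬ Done (toℕ i) v
    v∉ d = <⇒≱ (≤-reflexive (trans (sym (+-suc (slot ρ v) (toℕ i))) slot+)) d

    Closed-at : (h s : Fin N → ℕ) → State → Set
    Closed-at h s σ = regs σ 1 ≡ toℕ i × regs σ 4 ≡ toℕ v × Context σ × mem σ 5 ≗ᶠ toℕ ×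
      ∃[ k ] ∃[ n ] (Close (h v) (s v) k n × mem σ 7 ≗ᶠ put h v k × mem σ 8 ≗ᶠ put s v n)

    put-same : ∀ (g : Fin N → ℕ) u → g u ≡ put g v (g v) u
    put-same g u = case (v Fin.≟ u)
      where
      case : Dec (v ≡ u) → g u ≡ put g v (g v) u
      case (yes refl) = sym (put-hit g v (g v))
      case (no ne) = sym (put-miss g v (g v) ne)

    close-wp : ∀ {h s} σ → regs σ 1 ≡ toℕ i → Context σ → mem σ 5 ≗ᶠ toℕ → mem σ 7 ≗ᶠ h → mem σ 8 ≗ᶠ s →
      wp close (Closed-at h s) σ
    close-wp {h} {s} σ r C@(r0 , r2 , r3 , m0 , m1 , m6) m5 m7 m8 = over , under
      where
      r4 : mem σ 6 (regs σ 0 ∸ (regs σ 1 + 1)) ≡ toℕ v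
      r4 = trans (cong (mem σ 6) (trans (cong₂ _∸_ r0 (trans (cong (_+ 1) r) (+-comm (toℕ i) 1))) (sym (Fin.opposite-prop i))))
                 (at m6 (Fin.opposite i))
      x = mem σ 6 (regs σ 0 ∸ (regs σ 1 + 1))
      test : mem σ 8 x ∸ regs σ 2 ≡ s v ∸ b
      test = cong₂ _∸_ (trans (cong (mem σ 8) r4) (at m8 v)) r2
      over : mem σ 8 x ∸ regs σ 2 ≢ 0 → _
      over ne = r , r4 , C , m5 , suc (h v) , 1 ,
        full (≰⇒> λ le → ne (trans test (m≤n⇒m∸n≡0 le))) ,
        ≗ᶠ-update m7 r4 (trans (cong (λ y → mem σ 7 y + 1) r4) (trans (+-comm _ 1) (cong suc (at m7 v)))) ,
        ≗ᶠ-update m8 r4 refl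
      under : mem σ 8 x ∸ regs σ 2 ≡ 0 → _
      under eq = r , r4 , C , m5 , h v , s v , room (m∸n≡0⇒m≤n (trans (sym test) eq)) ,
        pointwise (λ u → trans (at m7 u) (put-same h u)) , pointwise (λ u → trans (at m8 u) (put-same s u))

    push-wp : ∀ {h s} → Partial (done? (toℕ i)) h s → ∀ σ → Closed-at h s σ →
      wp push (λ σ′ → regs σ′ 1 ≡ toℕ i × Ascending (suc (toℕ i)) (setReg σ′ 1 (suc (toℕ i)))) σ
    push-wp {h} {s} S σ (r , r4 , C@(r0 , r2 , r3 , m0 , m1 , m6) , m5 , k , n , cl , m7 , m8) = wide (v Fin.≟ root t)
      where
      h₁ s₁ : Fin N → ℕ
      h₁ = put h v k
      s₁ = put s v n
      hv : h₁ v ≡ k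
      hv = put-hit h v k
      old≢v : ∀ {u} → Done (toℕ i) u → v ≢ u
      old≢v d refl = v∉ d
      r5 : mem σ 0 (regs σ 4) ≡ toℕ p
      r5 = trans (cong (mem σ 0) r4) (at m0 v)
      h4 : mem σ 7 (regs σ 4) ≡ k
      h4 = trans (cong (mem σ 7) r4) (trans (at m7 v) hv)
      h5 : mem σ 7 (mem σ 0 (regs σ 4)) ≡ h₁ p
      h5 = trans (cong (mem σ 7) r5) (at m7 p)
      s4 : mem σ 8 (regs σ 4) ≡ n
      s4 = trans (cong (mem σ 8) r4) (trans (at m8 v) (put-hit s v n))
      s5 : mem σ 8 (mem σ 0 (regs σ 4)) ≡ s₁ p
      s5 = trans (cong (mem σ 8) r5) (at m8 p)
      Post : State → Set
      Post σ′ = regs σ′ 1 ≡ toℕ i × Ascending (suc (toℕ i)) (setReg σ′ 1 (suc (toℕ i)))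

      module Rooted-step (v≡r : v ≡ root t) where
        p≡v : p ≡ v
        p≡v = trans (cong par v≡r) (trans (root-parent t) (sym v≡r))
        level-with-h : mem σ 7 (mem σ 0 (regs σ 4)) ≡ mem σ 7 (regs σ 4)
        level-with-h = trans h5 (trans (cong h₁ p≡v) (trans hv (sym h4)))
        partial : ∀ {s₂} → Partial (done? (suc (toℕ i))) h₁ s₂
        partial = Step.at-root (done? (toℕ i)) (done? (suc (toℕ i))) done-old done-now done-only v∉
          (done-closed _) (done-closed _) S {h₂ = h₁} (λ d → put-miss h v k (old≢v d)) cl hv v≡r

      module Inner-step (v≢r : v ≢ root t) where
        v≢p : v ≢ p
        v≢p e = 1+n≢n (trans (sym (depth-suc v≢r)) (cong depth e))
        hp : h₁ p ≡ h p
        hp = put-miss h v k v≢p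
        sp : s₁ p ≡ s p
        sp = put-miss s v n v≢p
        partial : ∀ {h₂ s₂ h′ s′} → Push k n (h p) (s p) h′ s′ →
          (∀ u → p ≢ u → h₂ u ≡ h₁ u) → (∀ u → p ≢ u → s₂ u ≡ s₁ u) →
          h₂ p ≡ h′ → s₂ p ≡ s′ → Partial (done? (suc (toℕ i))) h₂ s₂
        partial ps h-same s-same h₂p s₂p =
          Step.below-root (done? (toℕ i)) (done? (suc (toℕ i))) done-old done-now done-only v∉
          (done-closed _) (done-closed _) S
          (λ d → trans (h-same _ (old≢p d)) (put-miss h v k (old≢v d))) cl
          (trans (h-same v (λ e → v≢p (sym e))) hv) v≢r ps h₂p s₂p
          (λ d ne → trans (h-same _ (λ e → ne (sym e))) (put-miss h v k (λ { refl → d done-now })) ,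
                    trans (s-same _ (λ e → ne (sym e))) (put-miss s v n (λ { refl → d done-now })))
          where
          old≢p : ∀ {u} → Done (toℕ i) u → p ≢ u
          old≢p d refl = v∉ (done-closed (toℕ i) d (parent⊒ v))

      wide : Dec (v ≡ root t) → wp push Post σ
      -- Node and parent coincide, so both comparisons come out equal and the last branch changes
      -- nothing but the root's size.
      wide (yes v≡r) = (λ ne → contradiction (m≤n⇒m∸n≡0 (≤-reflexive (sym level-with-h))) ne) , λ _ →
        (λ ne → contradiction (m≤n⇒m∸n≡0 (≤-reflexive level-with-h)) ne) , λ _ →
        r , C , m5 , h₁ , _ , m7 , pointwise (λ _ → refl) , partial
        where open Rooted-step v≡r
      wide (no v≢r) = higher , λ k≤hp → lower , level-with k≤hp
        where
        open Inner-step v≢r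
        y = regs σ 4
        x = mem σ 0 y
        σ₅ = setReg σ 5 x
        hp′ : mem σ 7 (mem σ 0 (regs σ 4)) ≡ h p
        hp′ = trans h5 hp
        gt : ∀ {a b c d} → a ≡ c → b ≡ d → a ∸ b ≢ 0 → d < c
        gt refl refl ne = ≰⇒> λ le → ne (m≤n⇒m∸n≡0 le)
        le : ∀ {a b c d} → a ≡ c → b ≡ d → a ∸ b ≡ 0 → c ≤ d
        le refl refl e = m∸n≡0⇒m≤n e
        higher : mem σ 7 y ∸ mem σ 7 x ≢ 0 →
          Post (setArray (setArray σ₅ 7 (update (mem σ 7) x (mem σ 7 y))) 8 (update (mem σ 8) x (mem σ 8 y + 1)))
        higher ne = r , C , m5 , put h₁ p k , put s₁ p (suc n) ,
          ≗ᶠ-update m7 r5 h4 , ≗ᶠ-update m8 r5 (trans (cong (_+ 1) s4) (+-comm n 1)) ,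
          partial (above (gt h4 hp′ ne)) (λ u → put-miss h₁ p k) (λ u → put-miss s₁ p (suc n)) (put-hit h₁ p k) (put-hit s₁ p (suc n))
        lower : mem σ 7 x ∸ mem σ 7 y ≢ 0 → Post σ₅
        lower ne = r , C , m5 , h₁ , s₁ , m7 , m8 ,
          partial (below (gt hp′ h4 ne)) (λ u _ → refl) (λ u _ → refl) hp sp
        level-with : mem σ 7 y ∸ mem σ 7 x ≡ 0 → mem σ 7 x ∸ mem σ 7 y ≡ 0 →
          Post (setArray σ₅ 8 (update (mem σ 8) x (mem σ 8 x + mem σ 8 y)))
        level-with k≤hp hp≤k = r , C , m5 , h₁ , put s₁ p (s p + n) , m7 ,
          ≗ᶠ-update m8 r5 (cong₂ _+_ (trans s5 sp) s4) ,
          partial (level (≤-antisym (le hp′ h4 hp≤k) (le h4 hp′ k≤hp)))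
            (λ u _ → refl) (λ u → put-miss s₁ p (s p + n)) hp (put-hit s₁ p (s p + n))

  ascend-step : ∀ i σ → regs σ 1 ≡ toℕ i → Ascending (toℕ i) σ →
    wp ascend (λ σ′ → regs σ′ 1 ≡ toℕ i × Ascending (suc (toℕ i)) (setReg σ′ 1 (suc (toℕ i)))) σ
  ascend-step i σ r (C , m5 , h , s , m7 , m8 , S) =
    wp-mono close {Q = Ascend.Closed-at i h s}
      {R = wp push (λ σ′ → regs σ′ 1 ≡ toℕ i × Ascending (suc (toℕ i)) (setReg σ′ 1 (suc (toℕ i))))} {σ = σ}
      (Ascend.push-wp i S) (Ascend.close-wp i σ r C m5 m7 m8)

  run-ascend : ∀ σ → Preparing N σ → Linear {A} N (for ascend) (Ascending N) (forTime ascend) σ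
  run-ascend σ (C , f7 , f8 , f5) = for-rule ascend Ascending (λ ((e , _) , _) → e) ascend-step
    σ (C , filled-N f5 , _ , _ , filled-N f7 , filled-N f8 ,
       partial-start (done? 0) (λ v d → <⇒≱ (Fin.toℕ<n (ρ ⟨$⟩ˡ v)) (subst (N ≤_) (+-identityʳ _) d)))

  module Tops (h : Fin N → ℕ) (greedy : Greedy b h) where

    Topped : (Fin N → Fin N) → Fin N → Set
    Topped top v = (h v ≡ h (par v) → top v ≡ top (par v)) × top v ⊒ v × h (top v) ≡ h v

    record TopsUpTo (j : ℕ) (top : Fin N → Fin N) : Set where
      field
        reached   : ∀ v → slot ρ v < j → Topped top v
        unreached : ∀ v → j ≤ slot ρ v → top v ≡ v

    Descending : ℕ → State → Set
    Descending j σ = Context σ × mem σ 7 ≗ᶠ h × ∃[ top ] (mem σ 5 ≗ᶠ (λ v → toℕ (top v)) × TopsUpTo j top)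

    slot-parent : ∀ v → v ≢ root t → slot ρ (par v) < slot ρ v
    slot-parent v v≢r = ordered _ _ (≤-reflexive (sym (depth-suc v≢r)))

    module _ (i : Fin N) {top : Fin N → Fin N} (T : TopsUpTo (toℕ i) top) where
      open TopsUpTo T

      v p : Fin N
      v = ρ ⟨$⟩ʳ i
      p = par v

      slot-v : slot ρ v ≡ toℕ i
      slot-v = cong toℕ (inverseˡ ρ)

      top-v : top v ≡ v
      top-v = unreached v (≤-reflexive (sym slot-v))

      fresh : h v ≢ h p → TopsUpTo (suc (toℕ i)) top
      fresh ne = record
        { reached = λ u lt → [ reached u , (λ e → at-v u (slot-injective ρ (trans e (sym slot-v)))) ]′ (m≤n⇒m<n∨m≡n (s≤s⁻¹ lt))
        ; unreached = λ u le → unreached u (<⇒≤ le) }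
        where
        at-v : ∀ u → u ≡ v → Topped top u
        at-v u refl = (λ e → contradiction e ne) , subst (_⊒ v) (sym top-v) ⊒-refl , cong h top-v

      -- A parent other than `v` precedes `v` in the depth order and already has its top; at the
      -- root `p` is `v`, whose entry is still `v` itself.
      top-p : h v ≡ h p → top p ⊒ v × h (top p) ≡ h v
      top-p e with v Fin.≟ root t
      ... | yes v≡r = subst (λ x → top x ⊒ v × h (top x) ≡ h v) (sym p≡v) (subst (_⊒ v) (sym top-v) ⊒-refl , cong h top-v)
        where
        p≡v : p ≡ v
        p≡v = trans (cong par v≡r) (trans (root-parent t) (sym v≡r))
      ... | no v≢r with reached p (subst (slot ρ p <_) slot-v (slot-parent v v≢r))
      ...   | _ , a , e′ = ⊒-trans a (parent⊒ v) , trans e′ (sym e)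

      joined-top : ∀ {top′ : Fin N → Fin N} → h v ≡ h p → top′ v ≡ top p → (∀ u → u ≢ v → top′ u ≡ top u) →
        TopsUpTo (suc (toℕ i)) top′
      joined-top {top′} e hit miss = record
        { reached = λ u lt → [ before u , (λ e → at-v u (slot-injective ρ (trans e (sym slot-v)))) ]′ (m≤n⇒m<n∨m≡n (s≤s⁻¹ lt))
        ; unreached = λ u le → trans (miss u λ { refl → <⇒≢ le (sym slot-v) }) (unreached u (<⇒≤ le)) }
        where
        top′-p : top′ p ≡ top p
        top′-p with p Fin.≟ v
        ... | yes p≡v = trans (cong top′ p≡v) hit
        ... | no p≢v = miss p p≢v
        at-v : ∀ u → u ≡ v → Topped top′ u
        at-v u refl = (λ _ → trans hit (sym top′-p)) , subst (_⊒ v) (sym hit) (proj₁ (top-p e)) ,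
          trans (cong h hit) (proj₂ (top-p e))
        before : ∀ u → slot ρ u < toℕ i → Topped top′ u
        before u lt with reached u lt
        ... | inh , a , e′ = (λ e → trans top′u (trans (inh e) (sym (miss (par u) pu≢v)))) ,
          subst (_⊒ u) (sym top′u) a , trans (cong h top′u) e′
          where
          u≢v : u ≢ v
          u≢v refl = <⇒≢ lt slot-v
          top′u : top′ u ≡ top u
          top′u = miss u u≢v
          -- A node before `v` is no child of `v`, so changing the top of `v` cannot disturb it.
          pu≢v : par u ≢ v
          pu≢v e = <⇒≱ lt (subst (_≤ slot ρ u) slot-v (subst (λ x → slot ρ x ≤ slot ρ u) e (slot-⊒ (parent⊒ u))))

    step : ∀ i σ → regs σ 1 ≡ toℕ i → Descending (toℕ i) σ →
      wp descend-tops (λ σ′ → regs σ′ 1 ≡ toℕ i × Descending (suc (toℕ i)) (setReg σ′ 1 (suc (toℕ i)))) σ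
    step i σ r (C@(r0 , r2 , r3 , m0 , m1 , m6) , m7 , top , m5 , T) =
      (λ ne → r , C , m7 , top , m5 ,
        fresh i T (λ e → ne (trans (cong₂ _∸_ h5 h4) (trans (cong (λ x → h (p i T) ∸ x) e) (n∸n≡0 (h (p i T))))))) ,
      (λ z → r , C , m7 , top′ , pointwise stored ,
        joined-top i T (≤-antisym (Greedy.monotone greedy _) (m∸n≡0⇒m≤n (trans (sym (cong₂ _∸_ h5 h4)) z)))
          top′-hit (λ u → top′-miss u))
      where
      r4 : mem σ 6 (regs σ 1) ≡ toℕ (v i T)
      r4 = trans (cong (mem σ 6) r) (at m6 i)
      r5 : mem σ 0 (mem σ 6 (regs σ 1)) ≡ toℕ (p i T)
      r5 = trans (cong (mem σ 0) r4) (at m0 (v i T))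
      h4 : mem σ 7 (mem σ 6 (regs σ 1)) ≡ h (v i T)
      h4 = trans (cong (mem σ 7) r4) (at m7 (v i T))
      h5 : mem σ 7 (mem σ 0 (mem σ 6 (regs σ 1))) ≡ h (p i T)
      h5 = trans (cong (mem σ 7) r5) (at m7 (p i T))
      top′ : Fin N → Fin N
      top′ u = if does (u Fin.≟ v i T) then top (p i T) else top u
      top′-hit : top′ (v i T) ≡ top (p i T)
      top′-hit = cong (λ c → if c then top (p i T) else top (v i T)) (dec-true (v i T Fin.≟ v i T) refl)
      top′-miss : ∀ u → u ≢ v i T → top′ u ≡ top u
      top′-miss u ne = cong (λ c → if c then top (p i T) else top u) (dec-false (u Fin.≟ v i T) ne)
      stored : ∀ u → update (mem σ 5) (mem σ 6 (regs σ 1)) (mem σ 5 (mem σ 0 (mem σ 6 (regs σ 1)))) (toℕ u) ≡ toℕ (top′ u)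
      stored u with u Fin.≟ v i T
      ... | yes refl = trans (update-hit (mem σ 5) _ r4) (trans (cong (mem σ 5) r5) (at m5 (p i T)))
      ... | no ne = trans (update-miss (mem σ 5) _ (λ e → ne (Fin.toℕ-injective (trans (sym e) r4)))) (at m5 u)

    run-tops : ∀ σ → Context σ → mem σ 7 ≗ᶠ h → mem σ 5 ≗ᶠ toℕ →
      Linear {A} N (for descend-tops) (Descending N) (forTime descend-tops) σ
    run-tops σ C m7 m5 = for-rule descend-tops Descending (λ ((e , _) , _) → e) step σ
      (C , m7 , id , m5 , record { reached = λ _ () ; unreached = λ _ _ → refl })

    tops⇒level : ∀ {top} → TopsUpTo N top → Clustering b h top
    tops⇒level {top} T = record
      { greedy = greedy
      ; inherit = λ v → proj₁ (topped v)
      ; top⊒ = λ v → proj₁ (proj₂ (topped v))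
      ; top-h = λ v → proj₂ (proj₂ (topped v)) }
      where
      topped : ∀ v → Topped top v
      topped v = TopsUpTo.reached T v (Fin.toℕ<n (ρ ⟨$⟩ˡ v))

  Levelled : State → Set
  Levelled σ = Context σ × ∃[ h ] ∃[ top ] (mem σ 7 ≗ᶠ h × mem σ 5 ≗ᶠ (λ v → toℕ (top v)) × Clustering b h top)

  run-levels : ∀ σ → Ascending N σ → Linear {A} N (for descend-tops) Levelled (forTime descend-tops) σ
  run-levels σ (C , m5 , h , s , m7 , m8 , S) = linear-weaken
    (λ σ (C , m7 , top , m5 , T) → C , h , top , m7 , m5 , tops⇒level T) ≤-refl (run-tops σ C m7 m5)
    where open Tops h (partial-end (done? N) (λ v → m≤n+m N (slot ρ v)) S)

-- The whole program

split-and-refine : Program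
split-and-refine = setup ⨾ 3 ≔ reg 0 ⨾ doubling refine-level

module Refinement (A : BlackBox) {N : ℕ} (t : Tree N) (ρ : Permutation′ N)
  (ordered : ∀ u v → Rooted.depth t u < Rooted.depth t v → toℕ (ρ ⟨$⟩ˡ u) < toℕ (ρ ⟨$⟩ˡ v)) where
  open Machine A
  open Rooted t
  open Levels t
  open Sorting t
  open Arrays {N}
  open Quality t

  Refining : ℕ → State → Set
  Refining b σ = (regs σ 0 ≡ N × regs σ 2 ≡ b × mem σ 0 ≗ᶠ (λ v → toℕ (parent t v)) × mem σ 6 ≗ᶠ node ρ) ×
    ∃[ π ] ∃[ q ] (regs σ 3 ≡ q × mem σ 1 ≗ᶠ node π × Good b π q)

  -- The root is the only node of depth 0, hence first in the depth order; this is how `select`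
  -- finds its level.
  slot-root : slot ρ (root t) ≡ 0
  slot-root = conclude (x Fin.≟ root t)
    where
    0<N : 0 < N
    0<N = ≤-<-trans z≤n (Fin.toℕ<n (root t))
    x : Fin N
    x = ρ ⟨$⟩ʳ fromℕ< 0<N
    slot-x : slot ρ x ≡ 0
    slot-x = trans (cong toℕ (inverseˡ ρ)) (Fin.toℕ-fromℕ< 0<N)
    conclude : Dec (x ≡ root t) → slot ρ (root t) ≡ 0
    conclude (yes e) = subst (λ y → slot ρ y ≡ 0) e slot-x
    conclude (no x≢r) = contradiction
      (subst (slot ρ (root t) <_) slot-x (ordered (root t) x (subst₂ _<_ (sym depth-root) (sym (depth-suc x≢r)) z<s))) λ ()

  module _ (b : ℕ) (0<b : 0 < b) (π : Permutation′ N) (q : ℕ) (good : Good b π q) where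
    open LevelRun A t ρ ordered b 0<b π q

    Refined : State → Set
    Refined σ = regs σ 2 ≡ b × Refining (b + b) (setReg σ 2 (b + b))

    module _ {h : Fin N → ℕ} {top : Fin N → Fin N} (L : Clustering b h top) where

      g : ℕ
      g = suc (h (root t))

      SortFrame : ℕ → ℕ → (ℕ → ℕ) → (ℕ → ℕ) → Set
      SortFrame r2 r3 m0 m6 = r2 ≡ b × r3 ≡ g × m0 ≗ᶠ (λ v → toℕ (parent t v)) × m6 ≗ᶠ node ρ

      open SortRun A t SortFrame π top using (Base; run-sort)

      run-add : g + g ≤ q → (Σ[ π′ ∈ Permutation′ N ] ((∀ v → slot π′ v ≡ place π top v) × Refines top π π′ ×
             (∀ u v → toℕ (top u) < toℕ (top v) → slot π′ u < slot π′ v))) →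
        ∀ σ → Base σ → Linear {A} N sort Refined sortTime σ
      run-add 2g≤q (π′ , slot≡ , R , _) σ B = linear-weaken
        (λ σ ((r0 , r2 , r3 , m0 , m6) , m1) → r2 , (r0 , refl , m0 , m6) , π′ , g , r3 , m1 , good-add 0<b L good R 2g≤q)
        ≤-refl (run-sort π′ slot≡ σ B)

      Measured : State → Set
      Measured σ = regs σ 7 ≡ g × Context σ × mem σ 5 ≗ᶠ (λ v → toℕ (top v))

      run-choice : ∀ σ → Measured σ →
        Linear {A} N (cond (reg 7 ⊕ reg 7 ⊖ reg 3) skip (3 ≔ reg 7 ⨾ sort)) Refined (1 + (1 + sortTime)) σ
      run-choice σ (r7 , C@(r0 , r2 , r3 , m0 , m1 , m6) , m5) = linear
        (run-weaken (λ _ → id) (s≤s (m≤n+m ((1 + sortTime) * suc N) N))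
          (run-cond keep add))
        where
        test : regs σ 7 + regs σ 7 ∸ regs σ 3 ≡ g + g ∸ q
        test = cong₂ (λ x y → x + x ∸ y) r7 r3
        keep : regs σ 7 + regs σ 7 ∸ regs σ 3 ≢ 0 → Run skip Refined ((1 + sortTime) * suc N) σ
        keep ne = σ , 1 , skip , (r2 , (r0 , refl , m0 , m6) , π , q , r3 , m1 ,
          good-keep 0<b L good (≰⇒> λ le → ne (trans test (m≤n⇒m∸n≡0 le)))) , s≤s z≤n
        add : regs σ 7 + regs σ 7 ∸ regs σ 3 ≡ 0 → Run (3 ≔ reg 7 ⨾ sort) Refined ((1 + sortTime) * suc N) σ
        add e = Linear.run (linear-seq {Q = Base} 1
          (linear-const (_ , _ , assign , ((r0 , r2 , r7 , m0 , m6) , m5 , m1) , ≤-refl))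
          (run-add (m∸n≡0⇒m≤n (trans (sym test) e)) (sorted π top)))

      run-measured : ∀ σ → Context σ → mem σ 7 ≗ᶠ h → mem σ 5 ≗ᶠ (λ v → toℕ (top v)) →
        Linear {A} N select Refined selectTime σ
      run-measured σ C@(r0 , r2 , r3 , m0 , m1 , m6) m7 m5 = linear-seq {Q = Measured} 1
        (linear-const (_ , _ , assign , (trans (cong (_+ 1) (trans (cong (mem σ 7) root-node) (at m7 (root t)))) (+-comm (h (root t)) 1) ,
          C , m5) , ≤-refl)) run-choice
        where
        root-node : mem σ 6 0 ≡ toℕ (root t)
        root-node = trans (cong (mem σ 6) (sym slot-root)) (trans (at m6 (ρ ⟨$⟩ˡ root t)) (cong toℕ (inverseʳ ρ)))

    run-select : ∀ σ → Levelled σ → Linear {A} N select Refined selectTime σ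
    run-select σ (C , h , top , m7 , m5 , L) = run-measured L σ C m7 m5

    run-level : ∀ σ → Context σ → Linear {A} N refine-level Refined levelTime σ
    run-level σ C =
      linear-seq (forTime prepare) (run-prepare σ C) λ σ S →
      linear-seq (forTime ascend) (run-ascend σ S) λ σ S →
      linear-seq (forTime descend-tops) (run-levels σ S) run-select

  refine-step : ∀ b σ → 0 < b → Refining b σ →
    Run refine-level (λ σ → regs σ 2 ≡ b × Refining (b + b) (setReg σ 2 (b + b))) (levelTime * suc N) σ
  refine-step b σ 0<b ((r0 , r2 , m0 , m6) , π , q , r3 , m1 , good) =
    Linear.run (run-level b 0<b π q good σ (r0 , r2 , r3 , m0 , m1 , m6))

  refineTime : ℕ → ℕ
  refineTime f = 2 + f * (levelTime * suc N + 2)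

  run-refinement : ∀ f → N < 2 ^ f → ∀ σ → SetupRun.Recording A t ρ N σ →
    Run (3 ≔ reg 0 ⨾ doubling refine-level) (λ σ → ∃[ b ] (N < b × Refining b σ)) (1 + refineTime f) σ
  run-refinement f N<2^f σ ((r0 , m0) , m1 , m6) = run-seq
    {Q = λ σ → Refining 1 (setReg σ 2 1)}
    -- The starting order is `ρ`, left in array 1 by the setup, and the first threshold is `N`, as
    -- in `initial-pieces`.
    (_ , _ , assign , ((r0 , refl , m0 , filled-N m6) , ρ , N , r0 , m1 , good-start ρ) , ≤-refl)
    λ σ S → doubling-rule refine-level Refining (levelTime * suc N) (λ ((r0 , r2 , _) , _) → r0 , r2) refine-step σ S f N<2^f

overwrite-stores : ∀ {k M} (xs : Vec (Fin k) M) f → Stores (overwrite xs f) xs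
overwrite-stores {M = M} xs f i with toℕ i <? M
... | yes i<M = cong (λ j → toℕ (lookup xs j)) (Fin.fromℕ<-toℕ i i<M)
... | no i≮M = contradiction (Fin.toℕ<n i) i≮M

-- The number of rounds and the running time

n≤2^⌈log₂n⌉ : ∀ n → n ≤ 2 ^ ⌈log₂ n ⌉
n≤2^⌈log₂n⌉ n = go n (<-wellFounded n)
  where
  go : ∀ n (rs : Acc _<_ n) → n ≤ 2 ^ ⌈log2⌉ n rs
  go 0 _ = z≤n
  go 1 _ = s≤s z≤n
  go (suc (suc n)) (acc rs) = begin
    2 + n                                     ≡⟨ cong (2 +_) (⌊n/2⌋+⌈n/2⌉≡n n) ⟨
    2 + (⌊ n /2⌋ + ⌈ n /2⌉)                   ≤⟨ +-monoʳ-≤ 2 (+-monoˡ-≤ ⌈ n /2⌉ (⌊n/2⌋≤⌈n/2⌉ n)) ⟩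
    2 + (⌈ n /2⌉ + ⌈ n /2⌉)                   ≡⟨ cong suc (+-suc ⌈ n /2⌉ ⌈ n /2⌉) ⟨
    suc ⌈ n /2⌉ + suc ⌈ n /2⌉                 ≡⟨ cong (suc ⌈ n /2⌉ +_) (+-identityʳ _) ⟨
    2 * suc ⌈ n /2⌉                           ≤⟨ *-monoʳ-≤ 2 (go (suc ⌈ n /2⌉) (rs (⌈n/2⌉<n n))) ⟩
    2 * 2 ^ ⌈log2⌉ (suc ⌈ n /2⌉) (rs (⌈n/2⌉<n n)) ∎
    where open ≤-Reasoning

-- Enough doublings to exceed `N`, and at the same time the number of terms of `timeSum`.
rounds : ℕ → ℕ
rounds N = suc ⌈log₂ N ⌉

n<2^rounds : ∀ n → n < 2 ^ rounds n
n<2^rounds n = ≤-<-trans (n≤2^⌈log₂n⌉ n) (^-monoʳ-< 2 (s≤s (s≤s z≤n)) (n<1+n ⌈log₂ n ⌉))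

timeFactor : ℕ
timeFactor = forTime initialise + ((2 + (jumpTime + 2)) + (sortTime + forTime order-by-depth)) + (1 + (2 + (levelTime + 2)))

totalTime : ℕ → ℕ
totalTime N = setupTime N (rounds N) + (1 + (2 + rounds N * (levelTime * suc N + 2)))

-- Every contribution is a constant, linear, or linear once per round, and `M` dominates all three.
total≤ : ∀ N → totalTime N ≤ timeFactor * (suc N * rounds N)
total≤ N = begin
  totalTime N
    ≤⟨ +-mono-≤ (+-mono-≤ (linear≤ i) (+-mono-≤ (+-mono-≤ (const≤ 2) (loop≤ jumpTime)) (linear≤ s))) (+-mono-≤ (const≤ 1) (+-mono-≤ (const≤ 2) (loop≤ levelTime))) ⟩
  i * M + ((2 * M + (jumpTime + 2) * M) + s * M) + (1 * M + (2 * M + (levelTime + 2) * M))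
    ≡⟨ cong₂ _+_ (cong (i * M +_) (trans (cong (_+ s * M) (sym (*-distribʳ-+ M 2 (jumpTime + 2)))) (sym (*-distribʳ-+ M (2 + (jumpTime + 2)) s))))
         (trans (cong (1 * M +_) (sym (*-distribʳ-+ M 2 (levelTime + 2)))) (sym (*-distribʳ-+ M 1 (2 + (levelTime + 2))))) ⟩
  i * M + ((2 + (jumpTime + 2)) + s) * M + (1 + (2 + (levelTime + 2))) * M
    ≡⟨ cong (_+ (1 + (2 + (levelTime + 2))) * M) (*-distribʳ-+ M i ((2 + (jumpTime + 2)) + s)) ⟨
  (i + ((2 + (jumpTime + 2)) + s)) * M + (1 + (2 + (levelTime + 2))) * M
    ≡⟨ *-distribʳ-+ M (i + ((2 + (jumpTime + 2)) + s)) (1 + (2 + (levelTime + 2))) ⟨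
  timeFactor * M ∎
  where
  open ≤-Reasoning
  i = forTime initialise
  s = sortTime + forTime order-by-depth
  M = suc N * rounds N
  linear≤ : ∀ c → c * suc N ≤ c * M
  linear≤ c = *-monoʳ-≤ c (m≤m*n (suc N) (rounds N))
  const≤ : ∀ c → c ≤ c * M
  const≤ c = ≤-trans (≤-reflexive (sym (*-identityʳ c))) (*-monoʳ-≤ c (s≤s z≤n))
  loop≤ : ∀ c → rounds N * (c * suc N + 2) ≤ (c + 2) * M
  loop≤ c = begin
    rounds N * (c * suc N + 2)         ≤⟨ *-monoʳ-≤ (rounds N) (+-monoʳ-≤ (c * suc N) (m≤m*n 2 (suc N))) ⟩
    rounds N * (c * suc N + 2 * suc N) ≡⟨ cong (rounds N *_) (*-distribʳ-+ (suc N) c 2) ⟨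
    rounds N * ((c + 2) * suc N)       ≡⟨ *-comm (rounds N) _ ⟩
    (c + 2) * suc N * rounds N         ≡⟨ *-assoc (c + 2) (suc N) (rounds N) ⟩
    (c + 2) * M                        ∎

Result : BlackBox → ∀ {N} → Tree N → Set
Result A {N} t = Σ[ π ∈ Permutation′ N ] Σ[ τ ∈ ℕ ] (Outputs A split-and-refine t π τ ×
  (∀ (B : ℕ) .{{_ : NonZero B}} (s : Fin B) (m : ℕ) → IsMinCost t B m → linearCost t π B s ≤ 48 * m) ×
  τ ≤ timeFactor * (suc N * rounds N))

result : ∀ A {N} (t : Tree N) → Result A t
result A {N} t = assemble depth-order
  where
  open Levels t
  open Sorting t
  open Machine A
  open DepthRun A t
  open Arrays {N}
  assemble : Σ[ ρ ∈ Permutation′ N ] ((∀ v → slot ρ v ≡ place Perm.id depth-key v) ×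
               (∀ u v → Rooted.depth t u < Rooted.depth t v → slot ρ u < slot ρ v)) → Result A t
  assemble (ρ , slot≡ , ordered) = conclude whole
    where
    open Refinement A t ρ ordered
    open Quality t
    whole : Run split-and-refine (λ σ → ∃[ b ] (N < b × Refining b σ)) (totalTime N) (initial t)
    whole = run-seq (SetupRun.run-setup A t ρ slot≡ (rounds N) (n<2^rounds N) (initial t)
        (refl , pointwise (overwrite-stores (parents t) (λ _ → 0))))
      (run-refinement (rounds N) (n<2^rounds N))
    conclude : Run split-and-refine (λ σ → ∃[ b ] (N < b × Refining b σ)) (totalTime N) (initial t) → Result A t
    conclude (σ , τ , ex , (b , N<b , _ , π , q , _ , m1 , good) , τ≤) = π , τ ,
      (σ , ex , λ i → trans (at m1 i) (cong toℕ (sym (lookup∘tabulate (π ⟨$⟩ʳ_) i)))) ,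
      good⇒cost good N<b , ≤-trans τ≤ (total≤ N)

sum-≥ : ∀ {N} κ (f : ℕ → ℕ) → (∀ l → N ≤ κ * f l) → ∀ ls → N * length ls ≤ κ * sum (List.map f ls)
sum-≥ {N} κ f le [] = ≤-trans (≤-reflexive (*-zeroʳ N)) z≤n
sum-≥ {N} κ f le (l ∷ ls) = begin
  N * suc (length ls)                    ≡⟨ *-suc N (length ls) ⟩
  N + N * length ls                      ≤⟨ +-mono-≤ (le l) (sum-≥ κ f le ls) ⟩
  κ * f l + κ * sum (List.map f ls)      ≡⟨ *-distribˡ-+ κ (f l) _ ⟨
  κ * (f l + sum (List.map f ls))        ∎
  where open ≤-Reasoning

-- Each of the `rounds N` terms contributes at least `N` after multiplication by `κ`.
rounds≤timeSum : ∀ T κ {N} → (∀ B .{{_ : NonZero B}} → N ≤ κ * T N B) → N * rounds N ≤ κ * timeSum T N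
rounds≤timeSum T κ {N} le = subst (λ k → N * k ≤ κ * timeSum T N) (length-upTo (rounds N))
  (sum-≥ κ (λ l → T N (2 ^ l)) (λ l → le (2 ^ l) {{m^n≢0 2 l}}) (List.upTo (rounds N)))

theorem5 : Σ[ P ∈ Program ]
    (∀ (c : ℕ) → ∃[ C ]
    (∀ (A : BlackBox) → Approximates c A →
    Σ[ order ∈ (∀ {N} → Tree N → Permutation′ N) ]
    Σ[ steps ∈ (∀ {N} → Tree N → ℕ) ]
    ( (∀ {N} (t : Tree N) → Outputs A P t (order t) (steps t))
    × (∀ {N} (t : Tree N) (B : ℕ) .{{_ : NonZero B}} (s : Fin B) (m : ℕ) →
    IsMinCost t B m → linearCost t (order t) B s ≤ C * m)
    × (∀ (T : ℕ → ℕ → ℕ) → RunsInTime A T → Ω[N] T →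
    ∃[ K ] ∃[ n₁ ]
    (∀ {N} (t : Tree N) → n₁ ≤ N → steps t ≤ K * timeSum T N)))))
theorem5 = split-and-refine , λ c → 48 , λ A _ → package A (result A)
  where
  package : ∀ A → (∀ {N} (t : Tree N) → Result A t) →
    Σ[ order ∈ (∀ {N} → Tree N → Permutation′ N) ]
    Σ[ steps ∈ (∀ {N} → Tree N → ℕ) ]
    ( (∀ {N} (t : Tree N) → Outputs A split-and-refine t (order t) (steps t))
    × (∀ {N} (t : Tree N) (B : ℕ) .{{_ : NonZero B}} (s : Fin B) (m : ℕ) →
    IsMinCost t B m → linearCost t (order t) B s ≤ 48 * m)
    × (∀ (T : ℕ → ℕ → ℕ) → RunsInTime A T → Ω[N] T →
    ∃[ K ] ∃[ n₁ ]
    (∀ {N} (t : Tree N) → n₁ ≤ N → steps t ≤ K * timeSum T N)))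
  package A res = (λ t → proj₁ (res t)) , (λ t → proj₁ (proj₂ (res t))) ,
    (λ t → proj₁ (proj₂ (proj₂ (res t)))) ,
    (λ t → proj₁ (proj₂ (proj₂ (proj₂ (res t))))) ,
    -- The factor 2 replaces `suc N` by `N`, and `κ` comes from the lower bound on `T`.
    λ T _ (κ , n₀ , Ω) → timeFactor * (2 * κ) , n₀ , λ {N} t n₀≤N → begin
      proj₁ (proj₂ (res t))                         ≤⟨ proj₂ (proj₂ (proj₂ (proj₂ (res t)))) ⟩
      timeFactor * (suc N * rounds N)
        -- A tree has a root, so `N` is positive.
        ≤⟨ *-monoʳ-≤ timeFactor (*-monoˡ-≤ (rounds N) (suc≤2* (Fin.toℕ<n (root t)))) ⟩
      timeFactor * (2 * N * rounds N)               ≡⟨ cong (timeFactor *_) (*-assoc 2 N (rounds N)) ⟩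
      timeFactor * (2 * (N * rounds N))
        ≤⟨ *-monoʳ-≤ timeFactor (*-monoʳ-≤ 2 (rounds≤timeSum T κ λ B → Ω N B n₀≤N)) ⟩
      timeFactor * (2 * (κ * timeSum T N))          ≡⟨ cong (timeFactor *_) (*-assoc 2 κ (timeSum T N)) ⟨
      timeFactor * (2 * κ * timeSum T N)            ≡⟨ *-assoc timeFactor (2 * κ) (timeSum T N) ⟨
      timeFactor * (2 * κ) * timeSum T N            ∎
    where
    open ≤-Reasoning
    suc≤2* : ∀ {k n} → k < n → suc n ≤ 2 * n
    suc≤2* {n = suc n} _ = s≤s (≤-trans (m≤n+m (suc n) n) (≤-reflexive (cong (λ x → n + suc x) (sym (+-identityʳ n)))))
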